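{- $\mathrm{FO}_{\mathrm{bit}}(Q^{\mathrm{un}}_{\mathrm{Grp}})$ is not contained in $\mathrm{FO}(Q^{\mathrm{un}}_{\mathrm{Grp}})$.
   Context: Words over a finite ordered alphabet are viewed as finite structures with universe $\{1,\dots,n\}$, unary letter predicates $P_a$, linear order $<$, equality, constants min, max; FO is first-order logic over this signature, and $\mathrm{FO}_{\mathrm{bit}}$ additionally allows $\mathrm{BIT}(x,y)$, true iff the $x$th bit of the binary representation of $y$ is 1. Unary Lindström quantifier: for a language $L$ over ordered alphabet $(b_1,\dots,b_t)$ and formulas $\phi_1(x),\dots,\phi_{t-1}(x)$ (possibly with other free variables), $Q_L x[\phi_1,\dots,\phi_{t-1}]$ holds on $w$ of length $n$ iff the word of length $n$ whose $i$th letter is $b_j$ for the least $j$ with $\phi_j$ true at $x=i$, and $b_t$ if none, belongs to $L$. A groupoid is a finite set $G$ with an arbitrary binary operation; $\mathcal W(S,G)$, $S\subseteq G$, is the set of nonempty words over alphabet $G$ evaluating into $S$ under some legal bracketing. $\mathrm{FO}(Q^{\mathrm{un}}_{\mathrm{Grp}})$ (resp. $\mathrm{FO}_{\mathrm{bit}}(Q^{\mathrm{un}}_{\mathrm{Grp}})$) is the class of languages definable in FO (resp. $\mathrm{FO}_{\mathrm{bit}}$) extended by unary quantifiers $Q_L$ with $L=\mathcal W(S,G)$ for finite groupoids $G$, $S\subseteq G$, arbitrarily nested. -}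

module Defs where

open import Data.Bool using (Bool; true; false)
open import Data.Nat using (ℕ; zero; suc; _+_; _∸_; _^_; _<_; _%_; _/_)
open import Data.Nat.Properties using ()
open import Data.Fin using (Fin; toℕ; fromℕ; inject₁)
open import Data.Vec using (Vec; lookup; toList)
open import Data.List using (List; []; _∷_; [_]; _++_)
open import Data.Product using (Σ; _×_; _,_)
open import Data.Sum using (_⊎_)
open import Relation.Nullary using (¬_)
open import Relation.Binary.PropositionalEquality using (_≡_)

-- A finite groupoid with carrier Fin t (t ≥ 1, written suc t');
-- the ordered alphabet (b_1,…,b_t) is (0,…,t-1) in Fin order.
record Groupoid (t : ℕ) : Set where
  field
    op : Fin t → Fin t → Fin t

data Evaluates {t : ℕ} (G : Groupoid t) : List (Fin t) → Fin t → Set where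
  leaf : ∀ g → Evaluates G [ g ] g
  node : ∀ {u v a b} → Evaluates G u a → Evaluates G v b →
         Evaluates G (u ++ v) (Groupoid.op G a b)

InW : {t : ℕ} → Groupoid t → (Fin t → Bool) → List (Fin t) → Set
InW G S u = Σ _ λ g → Evaluates G u g × (S g ≡ true)

-- Syntax.  k = alphabet size (alphabet Fin k), m = number of free
-- variables (de Bruijn), bitOK = whether the BIT predicate is allowed.

data Term (m : ℕ) : Set where
  var : Fin m → Term m
  tmin tmax : Term m

data Formula (k : ℕ) : Bool → ℕ → Set where
  letter : ∀ {b m} → Fin k → Term m → Formula k b m
  less   : ∀ {b m} → Term m → Term m → Formula k b m
  equal  : ∀ {b m} → Term m → Term m → Formula k b m
  bit    : ∀ {m} → Term m → Term m → Formula k true m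
  neg    : ∀ {b m} → Formula k b m → Formula k b m
  conj   : ∀ {b m} → Formula k b m → Formula k b m → Formula k b m
  ex     : ∀ {b m} → Formula k b (suc m) → Formula k b m
  -- unary groupoid quantifier Q_{W(S,G)} x [φ_1,…,φ_{t-1}], |G| = t = suc t'
  grp    : ∀ {b m} (t' : ℕ) → Groupoid (suc t') → (Fin (suc t') → Bool) →
           (Fin t' → Formula k b (suc m)) → Formula k b m

-- Semantics on a word w of length suc n.  Position p : Fin (suc n)
-- stands for the element toℕ p + 1 of the universe {1,…,suc n}.

evalT : ∀ {m n} → (Fin m → Fin (suc n)) → Term m → Fin (suc n)
evalT env (var i) = env i
evalT env tmin    = Data.Fin.zero
evalT {n = n} env tmax = fromℕ n

-- BIT(x,y): the x-th bit (counted from 1 at the least significant end)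
-- of the binary representation of y is 1.
-- bitOf i y = the i-th bit of y, i = 0 least significant.
bitOf : ℕ → ℕ → ℕ
bitOf zero    y = y % 2
bitOf (suc i) y = bitOf i (y / 2)

BIT : ℕ → ℕ → Set
BIT x y = bitOf (x ∸ 1) y ≡ 1

Sat : ∀ {k b m n} → Formula k b m → Vec (Fin k) (suc n) →
      (Fin m → Fin (suc n)) → Set
Sat (letter a t) w env = lookup w (evalT env t) ≡ a
Sat (less t u)   w env = toℕ (evalT env t) < toℕ (evalT env u)
Sat (equal t u)  w env = evalT env t ≡ evalT env u
Sat (bit t u)    w env = BIT (suc (toℕ (evalT env t))) (suc (toℕ (evalT env u)))
Sat (neg φ)      w env = ¬ Sat φ w env
Sat (conj φ ψ)   w env = Sat φ w env × Sat ψ w env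
Sat (ex φ)       w env = Σ _ λ p → Sat φ w (extend p env)
  where
  extend : ∀ {m A} → A → (Fin m → A) → Fin (suc m) → A
  extend p e Data.Fin.zero    = p
  extend p e (Data.Fin.suc i) = e i
Sat {n = n} (grp t' G S φs) w env =
  -- v is the induced word: its i-th letter is b_j for the least j with
  -- φ_j true at x = i, and b_t if there is none; and v ∈ W(S,G).
  Σ (Vec (Fin (suc t')) (suc n)) λ v →
    ((i : Fin (suc n)) →
       (Σ (Fin t') λ j →
          (lookup v i ≡ inject₁ j) ×
          Sat (φs j) w (ext i) ×
          ((j' : Fin t') → toℕ j' < toℕ j → ¬ Sat (φs j') w (ext i)))
       ⊎
       ((lookup v i ≡ fromℕ t') ×
        ((j : Fin t') → ¬ Sat (φs j) w (ext i))))
    × InW G S (toList v)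
  where
  ext : Fin (suc n) → Fin (suc _) → Fin (suc n)
  ext p Data.Fin.zero    = p
  ext p (Data.Fin.suc i) = env i

Sentence : ℕ → Bool → Set
Sentence k b = Formula k b 0

noVars : ∀ {n} → Fin 0 → Fin (suc n)
noVars ()

_⊨_ : ∀ {k b n} → Vec (Fin k) (suc n) → Sentence k b → Set
w ⊨ φ = Sat φ w noVars

SameLanguage : ∀ {k b b'} → Sentence k b → Sentence k b' → Set
SameLanguage {k} φ ψ =
  (n : ℕ) (w : Vec (Fin k) (suc n)) → ((w ⊨ φ → w ⊨ ψ) × (w ⊨ ψ → w ⊨ φ))

{-# OPTIONS --safe #-}
module Submission where

-- Over a one-letter alphabet every formula without BIT, with free variables y and length n, is equivalent
-- to a quantifier-free Presburger formula in (y , n). For the groupoid quantifier: in x, the truth of a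
-- Presburger formula is periodic between boundedly many breakpoints, so the induced word consists of
-- boundedly many periodic blocks. A word with fixed block patterns is determined by its block lengths,
-- and by Parikh's theorem the lengths of the blocks of words in W(S,G) form a semilinear set. Hence the
-- lengths definable without BIT are ultimately periodic, whereas BIT defines the powers of two.

open import Defs
open import Algebra.Bundles using (CommutativeMonoid)
import Algebra.Properties.Monoid.Mult as Mult
import Algebra.Solver.CommutativeMonoid as CommutativeMonoidSolver
open import Data.Bool using (Bool; true; false)
open import Data.Nat as ℕ using (ℕ; zero; suc; NonZero; z≤n; s≤s; _^_)
import Data.Nat.Properties as ℕ
import Data.Nat.Divisibility as ℕ
open import Data.Nat.DivMod
  using (_%_; _/_; _mod_; m%n<n; m<n⇒m%n≡m; m≡m%n+[m/n]*n; m%n%n≡m%n; [m+kn]%n≡m%n; %-distribˡ-+;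
         m*n/n≡m; m*n%n≡0; m/n<m)
open import Data.Nat.Induction using (<-rec)
open import Data.Integer as ℤ using (ℤ; +_; -[1+_]; 0ℤ; 1ℤ; -1ℤ; +≤+)
import Data.Integer.Properties as ℤ
open import Data.Integer.Divisibility.Signed
  using (_∣_; divides; _∣?_; ∣m∣n⇒∣m+n; ∣n⇒∣m*n; ∣m⇒∣-m; *-monoʳ-∣; *-cancelˡ-∣; ∣-trans; ∣ᵤ⇒∣; ∣⇒∣ᵤ)
open import Data.Integer.Tactic.RingSolver using (solve-∀)
open import Data.Fin as Fin
  using (Fin; zero; suc; toℕ; fromℕ; fromℕ<; inject₁; combine; remQuot; finToFun; funToFin)
import Data.Fin.Properties as Fin
open import Data.Vec as Vec
  using (Vec; []; _∷_; zipWith; map; lookup; _++_; replicate; head; tail; sum; toList; tabulate)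
import Data.Vec.Properties as Vec
open import Data.Vec.Relation.Binary.Pointwise.Inductive using (Pointwise; []; _∷_)
open import Data.List as List using (List; []; _∷_; upTo; applyUpTo; length)
open import Data.List.Properties using (length-applyUpTo)
open import Data.List.Relation.Unary.All as All using (All; []; _∷_)
import Data.List.Relation.Unary.All.Properties as All
open import Data.List.Relation.Unary.Any as Any using (Any; here; there; index)
import Data.List.Relation.Unary.Any.Properties as Any
open import Data.List.Membership.Propositional using (find; lose)
open import Data.List.Membership.Propositional.Properties using (∈-upTo⁺; ∈-lookup; ∈-cartesianProductWith⁻)
open import Data.Product as Product using (Σ; ∃; ∃-syntax; _×_; _,_; proj₁; proj₂; map₂)
open import Data.Product.Function.NonDependent.Propositional using (_×-⇔_)
open import Data.Sum using (_⊎_; inj₁; inj₂)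
open import Data.Unit using (⊤; tt)
open import Data.Empty using (⊥)
open import Function using (_∘_; _⇔_; mk⇔; Equivalence)
open import Function.Properties.Equivalence using (⇔-isEquivalence)
open import Relation.Binary using (IsEquivalence)
open import Relation.Nullary using (¬_; Dec; yes; no; contradiction; ¬?; _×-dec_; decidable-stable)
open import Relation.Binary.PropositionalEquality

open Equivalence using (to; from)

-- The induction has to carry free variables: formulas below a groupoid quantifier mention outer
-- positions, so the block patterns of the induced word, not only the block lengths, vary with the
-- values of those variables. What the formula alone bounds is the number of blocks and the period.
-- Hence there are finitely many candidates for the patterns, and the translation can try them all,
-- while Presburger arithmetic checks which one fits.
--
-- For each candidate the grammar is fixed before any value is known. Bracketings are derivation
-- trees, so an arbitrary binary operation gives a context-free grammar. It is intersected with an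
-- automaton that guesses the block of every letter, and its Parikh vectors record block lengths
-- instead of numbers of letters.
--
-- Quantifier elimination serves twice. Without quantifiers the breakpoints in one variable come
-- from finitely many affine forms; and the formulas are decidable, so the least true formula at a
-- position can be found constructively.

⇔-refl : ∀ {A : Set} → A ⇔ A
⇔-refl = IsEquivalence.refl ⇔-isEquivalence

⇔-sym : ∀ {A B : Set} → A ⇔ B → B ⇔ A
⇔-sym = IsEquivalence.sym ⇔-isEquivalence

⇔-trans : ∀ {A B C : Set} → A ⇔ B → B ⇔ C → A ⇔ C
⇔-trans = IsEquivalence.trans ⇔-isEquivalence

≡⇒⇔ : ∀ {A B : Set} → A ≡ B → A ⇔ B
≡⇒⇔ refl = ⇔-refl

¬-⇔ : ∀ {A B : Set} → A ⇔ B → (¬ A) ⇔ (¬ B)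
¬-⇔ e = mk⇔ (_∘ from e) (_∘ to e)

-- Presburger arithmetic

-- An affine form: the coefficients of the variables, then the constant term.
Lin : ℕ → Set
Lin m = Vec ℤ (suc m)

val : ∀ {m} → Lin m → Vec ℕ m → ℤ
val {zero}  (c ∷ []) []       = c
val {suc m} (a ∷ t)  (x ∷ xs) = a ℤ.* + x ℤ.+ val t xs

infixl 6 _⊞_
infixl 7 _⊡_

_⊞_ : ∀ {m} → Lin m → Lin m → Lin m
_⊞_ = zipWith ℤ._+_

_⊡_ : ∀ {m} → ℤ → Lin m → Lin m
c ⊡ t = map (c ℤ.*_) t

const : ∀ {m} → ℤ → Lin m
const {zero}  c = c ∷ []
const {suc m} c = 0ℤ ∷ const c

x[_] : ∀ {m} → Fin m → Lin m
x[ zero ]  = 1ℤ ∷ const 0ℤ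
x[ suc i ] = 0ℤ ∷ x[ i ]

val-weaken : ∀ {m} (t : Lin m) x xs → val (0ℤ ∷ t) (x ∷ xs) ≡ val t xs
val-weaken t x xs = ring (+ x) (val t xs)
  where
  ring : ∀ x v → 0ℤ ℤ.* x ℤ.+ v ≡ v
  ring = solve-∀

val-⊞ : ∀ {m} (s t : Lin m) xs → val (s ⊞ t) xs ≡ val s xs ℤ.+ val t xs
val-⊞ (c ∷ []) (d ∷ []) [] = refl
val-⊞ (a ∷ s) (b ∷ t) (x ∷ xs) rewrite val-⊞ s t xs = ring a b (+ x) (val s xs) (val t xs)
  where
  ring : ∀ a b x u v → (a ℤ.+ b) ℤ.* x ℤ.+ (u ℤ.+ v) ≡ (a ℤ.* x ℤ.+ u) ℤ.+ (b ℤ.* x ℤ.+ v)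
  ring = solve-∀

val-⊡ : ∀ {m} c (t : Lin m) xs → val (c ⊡ t) xs ≡ c ℤ.* val t xs
val-⊡ c (d ∷ []) [] = refl
val-⊡ c (a ∷ t) (x ∷ xs) rewrite val-⊡ c t xs = ring c a (+ x) (val t xs)
  where
  ring : ∀ c a x u → (c ℤ.* a) ℤ.* x ℤ.+ c ℤ.* u ≡ c ℤ.* (a ℤ.* x ℤ.+ u)
  ring = solve-∀

val-const : ∀ {m} c (xs : Vec ℕ m) → val (const c) xs ≡ c
val-const c []       = refl
val-const c (x ∷ xs) = trans (val-weaken (const c) x xs) (val-const c xs)

val-x : ∀ {m} (i : Fin m) xs → val x[ i ] xs ≡ + lookup xs i
val-x zero (x ∷ xs) rewrite val-const 0ℤ xs = ring (+ x)
  where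
  ring : ∀ x → 1ℤ ℤ.* x ℤ.+ 0ℤ ≡ x
  ring = solve-∀
val-x (suc i) (x ∷ xs) = trans (val-weaken x[ i ] x xs) (val-x i xs)

data QF (m : ℕ) : Set where
  0≤_  : Lin m → QF m
  dvd  : ℕ → Lin m → QF m
  _∧_  : QF m → QF m → QF m
  not_ : QF m → QF m

infixr 6 _∧_

-- The divisor is offset by one to keep it positive.
⟦_⟧ : ∀ {m} → QF m → Vec ℕ m → Set
⟦ 0≤ t ⟧    xs = 0ℤ ℤ.≤ val t xs
⟦ dvd d t ⟧ xs = + suc d ∣ val t xs
⟦ φ ∧ ψ ⟧   xs = ⟦ φ ⟧ xs × ⟦ ψ ⟧ xs
⟦ not φ ⟧   xs = ¬ ⟦ φ ⟧ xs

⟦_⟧? : ∀ {m} (φ : QF m) xs → Dec (⟦ φ ⟧ xs)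
⟦ 0≤ t ⟧?    xs = 0ℤ ℤ.≤? val t xs
⟦ dvd d t ⟧? xs = + suc d ∣? val t xs
⟦ φ ∧ ψ ⟧?   xs = ⟦ φ ⟧? xs ×-dec ⟦ ψ ⟧? xs
⟦ not φ ⟧?   xs = ¬? (⟦ φ ⟧? xs)

true′ false′ : ∀ {m} → QF m
true′  = 0≤ const 0ℤ
false′ = not true′

⟦true′⟧ : ∀ {m} (xs : Vec ℕ m) → ⟦ true′ ⟧ xs
⟦true′⟧ xs = ℤ.≤-reflexive (sym (val-const 0ℤ xs))

opaque
  _⇒_ : ∀ {m} → QF m → QF m → QF m
  φ ⇒ ψ = not (φ ∧ not ψ)

  ⟦⇒⟧ : ∀ {m} (φ ψ : QF m) xs → ⟦ φ ⇒ ψ ⟧ xs ⇔ (⟦ φ ⟧ xs → ⟦ ψ ⟧ xs)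
  ⟦⇒⟧ φ ψ xs = mk⇔ forth λ f (p , ¬q) → ¬q (f p)
    where
    forth : ⟦ φ ⇒ ψ ⟧ xs → ⟦ φ ⟧ xs → ⟦ ψ ⟧ xs
    forth f p with ⟦ ψ ⟧? xs
    ... | yes q = q
    ... | no ¬q = contradiction (p , ¬q) f

  ⋀ : ∀ {m} n → (Fin n → QF m) → QF m
  ⋀ zero    φ = true′
  ⋀ (suc n) φ = φ zero ∧ ⋀ n (φ ∘ suc)

  ⋁ : ∀ {m} n → (Fin n → QF m) → QF m
  ⋁ n φ = not ⋀ n (λ i → not φ i)

  ⟦⋀⟧ : ∀ {m} n (φ : Fin n → QF m) xs → ⟦ ⋀ n φ ⟧ xs ⇔ (∀ i → ⟦ φ i ⟧ xs)
  ⟦⋀⟧ zero    φ xs = mk⇔ (λ _ ()) λ _ → ⟦true′⟧ xs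
  ⟦⋀⟧ (suc n) φ xs = mk⇔
    (λ { (p , ps) zero → p ; (p , ps) (suc i) → to (⟦⋀⟧ n (φ ∘ suc) xs) ps i })
    λ f → f zero , from (⟦⋀⟧ n (φ ∘ suc) xs) (f ∘ suc)

  ⟦⋁⟧ : ∀ {m} n (φ : Fin n → QF m) xs → ⟦ ⋁ n φ ⟧ xs ⇔ (∃[ i ] ⟦ φ i ⟧ xs)
  ⟦⋁⟧ n φ xs = mk⇔ (forth n φ) λ (i , p) f → to (⟦⋀⟧ n _ xs) f i p
    where
    forth : ∀ n (φ : Fin n → QF _) → ⟦ ⋁ n φ ⟧ xs → ∃[ i ] ⟦ φ i ⟧ xs
    forth zero    φ f = contradiction (⟦true′⟧ xs) f
    forth (suc n) φ f with ⟦ φ zero ⟧? xs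
    ... | yes p = zero , p
    ... | no ¬p with i , q ← forth n (φ ∘ suc) (λ g → f (¬p , g)) = suc i , q

mapLin : ∀ {m n} → (Lin m → Lin n) → QF m → QF n
mapLin f (0≤ t)    = 0≤ f t
mapLin f (dvd d t) = dvd d (f t)
mapLin f (φ ∧ ψ)   = mapLin f φ ∧ mapLin f ψ
mapLin f (not φ)   = not mapLin f φ

⟦mapLin⟧ : ∀ {m n} (f : Lin m → Lin n) {xs ys} → (∀ t → val (f t) ys ≡ val t xs) →
           ∀ φ → ⟦ mapLin f φ ⟧ ys ≡ ⟦ φ ⟧ xs
⟦mapLin⟧ f h (0≤ t)    = cong (0ℤ ℤ.≤_) (h t)
⟦mapLin⟧ f h (dvd d t) = cong (+ suc d ∣_) (h t)
⟦mapLin⟧ f h (φ ∧ ψ)   = cong₂ _×_ (⟦mapLin⟧ f h φ) (⟦mapLin⟧ f h ψ)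
⟦mapLin⟧ f h (not φ)   = cong ¬_ (⟦mapLin⟧ f h φ)

_≤′_ : ∀ {m} → Lin m → Lin m → QF m
s ≤′ t = 0≤ (t ⊞ -1ℤ ⊡ s)

⟦≤′⟧ : ∀ {m} (s t : Lin m) {xs a b} → val s xs ≡ + a → val t xs ≡ + b →
       ⟦ s ≤′ t ⟧ xs ⇔ a ℕ.≤ b
⟦≤′⟧ s t {xs} {a} {b} p q = mk⇔
  (λ h → ℤ.drop‿+≤+ (ℤ.0≤i-j⇒j≤i (subst (0ℤ ℤ.≤_) eq h)))
  (λ h → subst (0ℤ ℤ.≤_) (sym eq) (ℤ.i≤j⇒0≤j-i (+≤+ h)))
  where
  ring : ∀ a b → b ℤ.+ -1ℤ ℤ.* a ≡ b ℤ.- a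
  ring = solve-∀
  eq : val (t ⊞ -1ℤ ⊡ s) xs ≡ + b ℤ.- + a
  eq = trans (val-⊞ t _ xs) (trans (cong₂ ℤ._+_ q (trans (val-⊡ -1ℤ s xs) (cong (-1ℤ ℤ.*_) p))) (ring (+ a) (+ b)))

-- Quantifier elimination

atoms : ∀ {m} → QF m → List (Lin m)
atoms (0≤ t)    = t ∷ []
atoms (dvd d t) = []
atoms (φ ∧ ψ)   = atoms φ List.++ atoms ψ
atoms (not φ)   = atoms φ

modulus : ∀ {m} → QF m → ℕ
modulus (0≤ t)    = 1
modulus (dvd d t) = suc d
modulus (φ ∧ ψ)   = modulus φ ℕ.* modulus ψ
modulus (not φ)   = modulus φ

modulus≢0 : ∀ {m} (φ : QF m) → NonZero (modulus φ)
modulus≢0 (0≤ t)    = _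
modulus≢0 (dvd d t) = _
modulus≢0 (φ ∧ ψ)   = ℕ.m*n≢0 _ _ {{modulus≢0 φ}} {{modulus≢0 ψ}}
modulus≢0 (not φ)   = modulus≢0 φ

SameSign : ∀ {m} → Vec ℕ m → ℕ → ℕ → Lin (suc m) → Set
SameSign xs x y t = (0ℤ ℤ.≤ val t (x ∷ xs)) ⇔ (0ℤ ℤ.≤ val t (y ∷ xs))

_≡_[mod_] : ℕ → ℕ → ℕ → Set
x ≡ y [mod M ] = + M ∣ + x ℤ.- + y

≡mod-sym : ∀ {x y M} → x ≡ y [mod M ] → y ≡ x [mod M ]
≡mod-sym {x} {y} h = subst (_ ∣_) (ring (+ x) (+ y)) (∣m⇒∣-m h)
  where
  ring : ∀ a b → ℤ.- (a ℤ.- b) ≡ b ℤ.- a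
  ring = solve-∀

+-period : ∀ y M → (y ℕ.+ M) ≡ y [mod M ]
+-period y M = divides 1ℤ (trans (cong (ℤ._- + y) (ℤ.pos-+ y M)) (ring (+ y) (+ M)))
  where
  ring : ∀ y M → y ℤ.+ M ℤ.- y ≡ 1ℤ ℤ.* M
  ring = solve-∀

∣-val : ∀ {m} d (t : Lin (suc m)) xs {x y} → x ≡ y [mod d ] →
        + d ∣ val t (y ∷ xs) → + d ∣ val t (x ∷ xs)
∣-val d (a ∷ t) xs {x} {y} h p =
  subst (+ d ∣_) (ring a (+ x) (+ y) (val t xs)) (∣m∣n⇒∣m+n p (∣n⇒∣m*n a h))
  where
  ring : ∀ a x y s → (a ℤ.* y ℤ.+ s) ℤ.+ a ℤ.* (x ℤ.- y) ≡ a ℤ.* x ℤ.+ s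
  ring = solve-∀

-- Sign atoms are fixed by hypothesis, and a divisibility atom depends on x only modulo its divisor.
-- Quantifier elimination, the decomposition into blocks and the final contradiction all rest on
-- this.
stable : ∀ {m} (φ : QF (suc m)) {xs x y M} → modulus φ ℕ.∣ M → x ≡ y [mod M ] →
         All (SameSign xs x y) (atoms φ) → ⟦ φ ⟧ (x ∷ xs) ⇔ ⟦ φ ⟧ (y ∷ xs)
stable (0≤ t)    d∣M h (s ∷ []) = s
stable (dvd d t) {xs} {x} {y} d∣M h _ =
  mk⇔ (∣-val (suc d) t xs (≡mod-sym {x} {y} h′)) (∣-val (suc d) t xs {x} {y} h′)
  where
  h′ : x ≡ y [mod suc d ]
  h′ = ∣-trans (∣ᵤ⇒∣ d∣M) h
stable (φ ∧ ψ) {x = x} {y} d∣M h s =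
  stable φ (ℕ.∣-trans (ℕ.m∣m*n _) d∣M) h (All.++⁻ˡ (atoms φ) s) ×-⇔
  stable ψ (ℕ.∣-trans (ℕ.n∣m*n (modulus φ)) d∣M) h (All.++⁻ʳ (atoms φ) s)
stable (not φ) d∣M h s = ¬-⇔ (stable φ d∣M h s)

-- inst c u φ expresses φ at the x with (1 + c) x = u; atoms are scaled by 1 + c so that no division is needed.
inst : ∀ {m} → ℕ → Lin m → QF (suc m) → QF m
inst c u (0≤ (a ∷ s))    = 0≤ (a ⊡ u ⊞ + suc c ⊡ s)
inst c u (dvd d (a ∷ s)) = dvd (c ℕ.+ d ℕ.* suc c) (a ⊡ u ⊞ + suc c ⊡ s)
inst c u (φ ∧ ψ)         = inst c u φ ∧ inst c u ψ
inst c u (not φ)         = not inst c u φ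

module _ {m} (c : ℕ) (u : Lin m) (x : ℕ) (xs : Vec ℕ m) (h : + suc c ℤ.* + x ≡ val u xs) where

  val-inst : ∀ a s → val (a ⊡ u ⊞ + suc c ⊡ s) xs ≡ + suc c ℤ.* val (a ∷ s) (x ∷ xs)
  val-inst a s
    rewrite val-⊞ (a ⊡ u) (+ suc c ⊡ s) xs | val-⊡ a u xs | val-⊡ (+ suc c) s xs | sym h
    = ring (+ suc c) a (+ x) (val s xs)
    where
    ring : ∀ c a x s → a ℤ.* (c ℤ.* x) ℤ.+ c ℤ.* s ≡ c ℤ.* (a ℤ.* x ℤ.+ s)
    ring = solve-∀

  ⟦inst⟧ : ∀ φ → ⟦ inst c u φ ⟧ xs ⇔ ⟦ φ ⟧ (x ∷ xs)
  ⟦inst⟧ (0≤ (a ∷ s)) rewrite val-inst a s = mk⇔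
    (λ p → ℤ.*-cancelˡ-≤-pos 0ℤ v (+ suc c) (subst (ℤ._≤ + suc c ℤ.* v) (sym (ℤ.*-zeroʳ (+ suc c))) p))
    (λ p → subst (ℤ._≤ + suc c ℤ.* v) (ℤ.*-zeroʳ (+ suc c)) (ℤ.*-monoˡ-≤-nonNeg (+ suc c) p))
    where v = val (a ∷ s) (x ∷ xs)
  -- The stored number `c + d * suc c` is one less than `suc d * suc c`, so divisor and form are
  -- both scaled by `suc c`.
  ⟦inst⟧ (dvd d (a ∷ s)) rewrite val-inst a s = mk⇔
    (λ p → *-cancelˡ-∣ (+ suc c) (subst (_∣ + suc c ℤ.* v) eq p))
    (λ p → subst (_∣ + suc c ℤ.* v) (sym eq) (*-monoʳ-∣ (+ suc c) p))
    where
    v = val (a ∷ s) (x ∷ xs)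
    eq : + (suc d ℕ.* suc c) ≡ + suc c ℤ.* + suc d
    eq = trans (cong +_ (ℕ.*-comm (suc d) (suc c))) (ℤ.pos-* (suc c) (suc d))
  ⟦inst⟧ (φ ∧ ψ) = ⟦inst⟧ φ ×-⇔ ⟦inst⟧ ψ
  ⟦inst⟧ (not φ) = ¬-⇔ (⟦inst⟧ φ)

-- A pair `(c , u)` names the point u / (1 + c), one of the test points of Cooper's method. It need
-- not be an integer.
Test : ℕ → Set
Test m = ℕ × Lin m

Hit : ∀ {m} → Vec ℕ m → ℕ → Test m → Set
Hit xs x (c , u) = + suc c ℤ.* + x ≡ val u xs

-- Hit at every x where the sign of the form differs from its sign at x - M.
crossings : ∀ {m} → ℕ → Lin (suc m) → List (Test m)
crossings M (+ zero ∷ s)   = []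
crossings M (+ suc a ∷ s)  = List.map (λ k → a , -1ℤ ⊡ s ⊞ const (+ k)) (upTo (suc a ℕ.* M))
crossings M (-[1+ a ] ∷ s) = List.map (λ k → a , s ⊞ const (+ k)) (upTo (suc (suc a ℕ.* M)))

map-hit : ∀ {m xs x} (f : ℕ → Test m) {k n} → k ℕ.< n → Hit xs x (f k) → Any (Hit xs x) (List.map f (upTo n))
map-hit {xs = xs} {x} f k<n h = Any.map⁺ (lose {P = Hit xs x ∘ f} (∈-upTo⁺ k<n) h)

-- Over a step M the value of the form moves by exactly aM, where a is the absolute value of the
-- slope. If the slope is positive and the signs differ, the value k at y + M satisfies 0 ≤ k < aM.
-- If it is negative, that value is -k with 1 ≤ k ≤ aM; the bound aM is attained, which is why that
-- list in `crossings` is one longer.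
crossing : ∀ {m} (xs : Vec ℕ m) M y (t : Lin (suc m)) →
           SameSign xs (y ℕ.+ M) y t ⊎ Any (Hit xs (y ℕ.+ M)) (crossings M t)
crossing xs M y (+ zero ∷ s) = inj₁ (≡⇒⇔ (cong (0ℤ ℤ.≤_)
  (trans (val-weaken s (y ℕ.+ M) xs) (sym (val-weaken s y xs)))))
crossing xs M y (+ suc a ∷ s) = go (val (A ∷ s) (y ℕ.+ M ∷ xs)) refl (0ℤ ℤ.≤? val (A ∷ s) (y ∷ xs))
  where
  A = + suc a
  v = val s xs
  ring : ∀ A y M v → A ℤ.* (y ℤ.+ M) ℤ.+ v ≡ (A ℤ.* y ℤ.+ v) ℤ.+ A ℤ.* M
  ring = solve-∀
  ring′ : ∀ Ax v → Ax ≡ -1ℤ ℤ.* v ℤ.+ (Ax ℤ.+ v)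
  ring′ = solve-∀
  shift : val (A ∷ s) (y ℕ.+ M ∷ xs) ≡ val (A ∷ s) (y ∷ xs) ℤ.+ + (suc a ℕ.* M)
  shift = trans (cong (λ z → A ℤ.* z ℤ.+ v) (ℤ.pos-+ y M))
    (trans (ring A (+ y) (+ M) v) (cong (λ z → val (A ∷ s) (y ∷ xs) ℤ.+ z) (sym (ℤ.pos-* (suc a) M))))
  up : 0ℤ ℤ.≤ val (A ∷ s) (y ∷ xs) → 0ℤ ℤ.≤ val (A ∷ s) (y ℕ.+ M ∷ xs)
  up p = ℤ.≤-trans p (subst (val (A ∷ s) (y ∷ xs) ℤ.≤_) (sym shift) (ℤ.i≤i+j _ (+ (suc a ℕ.* M))))
  go : ∀ w → val (A ∷ s) (y ℕ.+ M ∷ xs) ≡ w → Dec (0ℤ ℤ.≤ val (A ∷ s) (y ∷ xs)) →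
       SameSign xs (y ℕ.+ M) y (A ∷ s) ⊎ Any (Hit xs (y ℕ.+ M)) (crossings M (A ∷ s))
  go w eq (yes p) = inj₁ (mk⇔ (λ _ → p) up)
  go (+ k) eq (no ¬p) = inj₂ (map-hit (λ k → a , -1ℤ ⊡ s ⊞ const (+ k)) k< hit)
    where
    k< : k ℕ.< suc a ℕ.* M
    k< = ℤ.drop‿+<+ (subst (ℤ._< + (suc a ℕ.* M)) (trans (sym shift) eq)
           (subst (val (A ∷ s) (y ∷ xs) ℤ.+ + (suc a ℕ.* M) ℤ.<_) (ℤ.+-identityˡ _) (ℤ.+-monoˡ-< (+ (suc a ℕ.* M)) (ℤ.≰⇒> ¬p))))
    hit : A ℤ.* + (y ℕ.+ M) ≡ val (-1ℤ ⊡ s ⊞ const (+ k)) xs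
    hit rewrite val-⊞ (-1ℤ ⊡ s) (const (+ k)) xs | val-⊡ -1ℤ s xs | val-const (+ k) xs | sym eq = ring′ _ v
  go -[1+ k ] eq (no ¬p) = inj₁ (mk⇔ (λ q → contradiction (subst (0ℤ ℤ.≤_) eq q) λ ()) (λ q → contradiction q ¬p))
crossing xs M y (-[1+ a ] ∷ s) = go (val (A ∷ s) (y ℕ.+ M ∷ xs)) refl (0ℤ ℤ.≤? val (A ∷ s) (y ∷ xs))
  where
  A = -[1+ a ]
  v = val s xs
  ring : ∀ A y M v → ℤ.- A ℤ.* (y ℤ.+ M) ℤ.+ v ℤ.+ A ℤ.* M ≡ ℤ.- A ℤ.* y ℤ.+ v
  ring = solve-∀
  ring′ : ∀ A x v → A ℤ.* x ≡ v ℤ.+ ℤ.- (ℤ.- A ℤ.* x ℤ.+ v)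
  ring′ = solve-∀
  shift : val (A ∷ s) (y ℕ.+ M ∷ xs) ℤ.+ + (suc a ℕ.* M) ≡ val (A ∷ s) (y ∷ xs)
  shift = trans (cong₂ (λ z w → A ℤ.* z ℤ.+ v ℤ.+ w) (ℤ.pos-+ y M) (ℤ.pos-* (suc a) M))
    (ring (+ suc a) (+ y) (+ M) v)
  down : 0ℤ ℤ.≤ val (A ∷ s) (y ℕ.+ M ∷ xs) → 0ℤ ℤ.≤ val (A ∷ s) (y ∷ xs)
  down p = ℤ.≤-trans p (subst (val (A ∷ s) (y ℕ.+ M ∷ xs) ℤ.≤_) shift (ℤ.i≤i+j _ (+ (suc a ℕ.* M))))
  go : ∀ w → val (A ∷ s) (y ℕ.+ M ∷ xs) ≡ w → Dec (0ℤ ℤ.≤ val (A ∷ s) (y ∷ xs)) →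
       SameSign xs (y ℕ.+ M) y (A ∷ s) ⊎ Any (Hit xs (y ℕ.+ M)) (crossings M (A ∷ s))
  go w eq (no ¬p) = inj₁ (mk⇔ down (λ q → contradiction q ¬p))
  go (+ k) eq (yes p) = inj₁ (mk⇔ (λ _ → p) (λ _ → subst (0ℤ ℤ.≤_) (sym eq) (+≤+ ℕ.z≤n)))
  go -[1+ k ] eq (yes p) = inj₂ (map-hit (λ k → a , s ⊞ const (+ k)) (ℕ.s≤s k<) hit)
    where
    k< : suc k ℕ.≤ suc a ℕ.* M
    k< = ℤ.drop‿+≤+ (ℤ.0≤i-j⇒j≤i (subst (0ℤ ℤ.≤_)
           (trans (sym shift) (trans (cong (ℤ._+ + (suc a ℕ.* M)) eq) (ℤ.+-comm -[1+ k ] (+ (suc a ℕ.* M))))) p))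
    hit : + suc a ℤ.* + (y ℕ.+ M) ≡ val (s ⊞ const (+ suc k)) xs
    hit rewrite val-⊞ s (const (+ suc k)) xs | val-const (+ suc k) xs =
      trans (ring′ (+ suc a) (+ (y ℕ.+ M)) v) (cong (λ z → v ℤ.+ ℤ.- z) eq)

tests : ∀ {m} → QF (suc m) → List (Test m)
tests φ = List.map (λ k → 0 , const (+ k)) (upTo (modulus φ))
    List.++ List.concatMap (crossings (modulus φ)) (atoms φ)

-- The first two conjuncts say that the test point is a natural number; only then does `inst` speak
-- of a possible value of the variable.
candidate : ∀ {m} → QF (suc m) → Test m → QF m
candidate φ (c , u) = dvd c u ∧ 0≤ u ∧ inst c u φ

opaque
  ∃′ : ∀ {m} → QF (suc m) → QF m
  ∃′ φ = ⋁ _ (λ i → candidate φ (List.lookup (tests φ) i))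

candidate-sound : ∀ {m} φ (test : Test m) xs → ⟦ candidate φ test ⟧ xs → ∃[ x ] ⟦ φ ⟧ (x ∷ xs)
candidate-sound φ (c , u) xs (divides (+ x) eq , _ , p) =
  x , to (⟦inst⟧ c u x xs (trans (ℤ.*-comm (+ suc c) (+ x)) (sym eq)) φ) p
candidate-sound φ (c , u) xs (divides -[1+ q ] eq , 0≤u , p) = contradiction (subst (0ℤ ℤ.≤_) eq 0≤u) λ ()

candidate-complete : ∀ {m} φ (test : Test m) {xs x} → ⟦ φ ⟧ (x ∷ xs) → Hit xs x test → ⟦ candidate φ test ⟧ xs
candidate-complete φ (c , u) {xs} {x} p h =
  divides (+ x) (trans (sym h) (ℤ.*-comm (+ suc c) (+ x))) ,
  subst (0ℤ ℤ.≤_) (trans (ℤ.pos-* (suc c) x) h) (+≤+ ℕ.z≤n) ,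
  from (⟦inst⟧ c u x xs h φ) p

-- A solution x can be decreased by the modulus until it is below the modulus or an atom changes sign.
test-complete : ∀ {m} (φ : QF (suc m)) xs x → ⟦ φ ⟧ (x ∷ xs) → Any (λ t → ⟦ candidate φ t ⟧ xs) (tests φ)
test-complete φ xs = <-rec _ step
  where
  M = modulus φ
  found : ∀ {x} → ⟦ φ ⟧ (x ∷ xs) → Any (Hit xs x) (tests φ) → Any (λ t → ⟦ candidate φ t ⟧ xs) (tests φ)
  found p = Any.map (λ {t} → candidate-complete φ t p)
  split : ∀ x → M ℕ.≤ x → ∃[ y ] x ≡ y ℕ.+ M
  split x M≤x = x ℕ.∸ M , sym (ℕ.m∸n+n≡m M≤x)
  step : ∀ x → (∀ {y} → y ℕ.< x → ⟦ φ ⟧ (y ∷ xs) → _) → ⟦ φ ⟧ (x ∷ xs) → _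
  step x rec p with x ℕ.<? M
  ... | yes x<M = found p (Any.++⁺ˡ (map-hit (λ k → 0 , const (+ k)) x<M
                    (trans (ℤ.*-identityˡ (+ x)) (sym (val-const (+ x) xs)))))
  ... | no x≮M with y , refl ← split x (ℕ.≮⇒≥ x≮M)
               with All.decide (crossing xs M y) (atoms φ)
  ... | inj₁ same = rec (ℕ.m<m+n y (ℕ.>-nonZero⁻¹ M {{modulus≢0 φ}})) (to (stable φ ℕ.∣-refl (+-period y M) same) p)
  ... | inj₂ hit  = found p (Any.++⁺ʳ (List.map _ (upTo M)) (Any.concatMap⁺ (crossings M) hit))

opaque
  unfolding ∃′

  ⟦∃′⟧ : ∀ {m} (φ : QF (suc m)) xs → ⟦ ∃′ φ ⟧ xs ⇔ (∃[ x ] ⟦ φ ⟧ (x ∷ xs))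
  ⟦∃′⟧ φ xs = ⇔-trans (⟦⋁⟧ _ _ xs) (mk⇔
    (λ (i , p) → candidate-sound φ (List.lookup (tests φ) i) xs p)
    (λ (x , p) → let c = test-complete φ xs x p in index c , Any.lookup-index c))

opaque
  ∀′ : ∀ {m} → QF (suc m) → QF m
  ∀′ φ = not ∃′ (not φ)

  ⟦∀′⟧ : ∀ {m} (φ : QF (suc m)) xs → ⟦ ∀′ φ ⟧ xs ⇔ (∀ x → ⟦ φ ⟧ (x ∷ xs))
  ⟦∀′⟧ φ xs = mk⇔ forth λ f e → let (x , ¬p) = to (⟦∃′⟧ (not φ) xs) e in ¬p (f x)
    where
    forth : ⟦ ∀′ φ ⟧ xs → ∀ x → ⟦ φ ⟧ (x ∷ xs)
    forth f x with ⟦ φ ⟧? (x ∷ xs)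
    ... | yes p = p
    ... | no ¬p = contradiction (from (⟦∃′⟧ (not φ) xs) (x , ¬p)) f

  ∃⋯ : ∀ {m} k → QF (k ℕ.+ m) → QF m
  ∃⋯ zero    φ = φ
  ∃⋯ (suc k) φ = ∃⋯ k (∃′ φ)

  ⟦∃⋯⟧ : ∀ {m} k (φ : QF (k ℕ.+ m)) xs → ⟦ ∃⋯ k φ ⟧ xs ⇔ (∃[ ls ] ⟦ φ ⟧ (ls ++ xs))
  ⟦∃⋯⟧ zero    φ xs = mk⇔ (λ p → [] , p) λ { ([] , p) → p }
  ⟦∃⋯⟧ (suc k) φ xs = ⇔-trans (⟦∃⋯⟧ k (∃′ φ) xs) (mk⇔
    (λ (ls , p) → let (l , q) = to (⟦∃′⟧ φ _) p in l ∷ ls , q)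
    λ { (l ∷ ls , q) → ls , from (⟦∃′⟧ φ _) (l , q) })

-- Parikh's theorem

infixl 6 _+ᵥ_

_+ᵥ_ : ∀ {r} → Vec ℕ r → Vec ℕ r → Vec ℕ r
_+ᵥ_ = zipWith ℕ._+_

0ᵥ : ∀ {r} → Vec ℕ r
0ᵥ = replicate _ 0

+ᵥ-0-commutativeMonoid : ℕ → CommutativeMonoid _ _
+ᵥ-0-commutativeMonoid r = record
  { Carrier = Vec ℕ r
  ; _≈_ = _≡_
  ; _∙_ = _+ᵥ_
  ; ε = 0ᵥ
  ; isCommutativeMonoid = record
    { isMonoid = record
      { isSemigroup = record
        { isMagma = record { isEquivalence = isEquivalence ; ∙-cong = cong₂ _+ᵥ_ }
        ; assoc = Vec.zipWith-assoc ℕ.+-assoc }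
      ; identity = Vec.zipWith-identityˡ ℕ.+-identityˡ , Vec.zipWith-identityʳ ℕ.+-identityʳ }
    ; comm = Vec.zipWith-comm ℕ.+-comm } }

module +ᵥ {r} = CommutativeMonoid (+ᵥ-0-commutativeMonoid r)
module S {r} = CommutativeMonoidSolver (+ᵥ-0-commutativeMonoid r)
open S using (solve; _⊜_)

data Pow {r} (P : Vec ℕ r → Set) : ℕ → Vec ℕ r → Set where
  []  : Pow P 0 0ᵥ
  _∷_ : ∀ {c u v} → P u → Pow P c v → Pow P (suc c) (u +ᵥ v)

module _ {r} {P : Vec ℕ r → Set} where

  Pow-map : ∀ {Q : Vec ℕ r → Set} → (∀ {v} → P v → Q v) → ∀ {c s} → Pow P c s → Pow Q c s
  Pow-map f []       = []
  Pow-map f (p ∷ ps) = f p ∷ Pow-map f ps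

  Pow-++ : ∀ {a b s t} → Pow P a s → Pow P b t → Pow P (a ℕ.+ b) (s +ᵥ t)
  Pow-++ {t = t} [] qs = subst (Pow P _) (sym (+ᵥ.identityˡ t)) qs
  Pow-++ {t = t} (_∷_ {u = u} {v} p ps) qs =
    subst (Pow P _) (sym (+ᵥ.assoc u v t)) (p ∷ Pow-++ ps qs)

  Pow-split : ∀ a {b s} → Pow P (a ℕ.+ b) s → ∃[ s₁ ] ∃[ s₂ ] Pow P a s₁ × Pow P b s₂ × s ≡ s₁ +ᵥ s₂
  Pow-split zero    {s = s} ps = 0ᵥ , s , [] , ps , sym (+ᵥ.identityˡ s)
  Pow-split (suc a) (_∷_ {u = u} p ps) with s₁ , s₂ , qs , qs′ , refl ← Pow-split a ps =
    u +ᵥ s₁ , s₂ , p ∷ qs , qs′ , sym (+ᵥ.assoc u s₁ s₂)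

-- Commutative context-free grammars: k nonterminals, r terminals. Rules may use star, so that
-- the closed expressions are the rational ones.
data Exp (k r : ℕ) : Set where
  ∅    : Exp k r
  sing : Vec ℕ r → Exp k r
  nt   : Fin k → Exp k r
  _∪_  : Exp k r → Exp k r → Exp k r
  _⊕_  : Exp k r → Exp k r → Exp k r
  _⋆   : Exp k r → Exp k r

infixr 5 _∪_
infixr 6 _⊕_
infix 7 _⋆
infixr 8 _◂_
infix 3 _⊢_∋_ _∋_

data _⊢_∋_ {k r} (ρ : Fin k → Exp k r) : Exp k r → Vec ℕ r → Set where
  sing : ∀ {w} → ρ ⊢ sing w ∋ w
  nt   : ∀ {A v} → ρ ⊢ ρ A ∋ v → ρ ⊢ nt A ∋ v
  inˡ  : ∀ {E F v} → ρ ⊢ E ∋ v → ρ ⊢ E ∪ F ∋ v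
  inʳ  : ∀ {E F v} → ρ ⊢ F ∋ v → ρ ⊢ E ∪ F ∋ v
  _⊕_  : ∀ {E F u v} → ρ ⊢ E ∋ u → ρ ⊢ F ∋ v → ρ ⊢ E ⊕ F ∋ u +ᵥ v
  []   : ∀ {E} → ρ ⊢ E ⋆ ∋ 0ᵥ
  _∷_  : ∀ {E u v} → ρ ⊢ E ∋ u → ρ ⊢ E ⋆ ∋ v → ρ ⊢ E ⋆ ∋ u +ᵥ v

noRules : ∀ {k r} → Fin 0 → Exp k r
noRules ()

_∋_ : ∀ {r} → Exp 0 r → Vec ℕ r → Set
E ∋ v = noRules ⊢ E ∋ v

-- Two functions on the empty type need not be definitionally equal, so derivations have to be
-- carried from one to the other.
closed : ∀ {r} {ρ σ : Fin 0 → Exp 0 r} {E v} → ρ ⊢ E ∋ v → σ ⊢ E ∋ v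
closed sing     = sing
closed (inˡ d)  = inˡ (closed d)
closed (inʳ d)  = inʳ (closed d)
closed (d ⊕ e)  = closed d ⊕ closed e
closed []       = []
closed (d ∷ ds) = closed d ∷ closed ds

⋆-++ : ∀ {k r} {ρ : Fin k → Exp k r} {E u v} → ρ ⊢ E ⋆ ∋ u → ρ ⊢ E ⋆ ∋ v → ρ ⊢ E ⋆ ∋ u +ᵥ v
⋆-++ {v = v} [] e = subst (_ ⊢ _ ∋_) (sym (+ᵥ.identityˡ v)) e
⋆-++ {v = v} (_∷_ {u = u} {w} d ds) e = subst (_ ⊢ _ ∋_) (sym (+ᵥ.assoc u w v)) (d ∷ ⋆-++ ds e)

-- { v ∣ 0 ∷ v ∈ E }
D₀ : ∀ {r} → Exp 0 (suc r) → Exp 0 r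
D₀ ∅                = ∅
D₀ (sing (0 ∷ w))     = sing w
D₀ (sing (suc _ ∷ _)) = ∅
D₀ (E ∪ F)          = D₀ E ∪ D₀ F
D₀ (E ⊕ F)          = D₀ E ⊕ D₀ F
D₀ (E ⋆)            = D₀ E ⋆

D₀-sound : ∀ {r} (E : Exp 0 (suc r)) {v} → D₀ E ∋ v → E ∋ 0 ∷ v
D₀-sound (sing (0 ∷ w)) sing = sing
D₀-sound (E ∪ F) (inˡ d)  = inˡ (D₀-sound E d)
D₀-sound (E ∪ F) (inʳ d)  = inʳ (D₀-sound F d)
D₀-sound (E ⊕ F) (d ⊕ e)  = D₀-sound E d ⊕ D₀-sound F e
D₀-sound (E ⋆)   []       = []
D₀-sound (E ⋆)   (d ∷ ds) = D₀-sound E d ∷ D₀-sound (E ⋆) ds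

D₀-sing : ∀ {r} (w : Vec ℕ (suc r)) → head w ≡ 0 → D₀ (sing w) ∋ tail w
D₀-sing (0 ∷ w) eq = sing

-- The first component is prescribed by an equation because indices such as `u +ᵥ v` cannot be
-- matched against `0 ∷ v`.
D₀-complete : ∀ {r} {E : Exp 0 (suc r)} {w} → E ∋ w → head w ≡ 0 → D₀ E ∋ tail w
D₀-complete (sing {w}) eq = D₀-sing w eq
D₀-complete (inˡ d) eq = inˡ (D₀-complete d eq)
D₀-complete (inʳ d) eq = inʳ (D₀-complete d eq)
D₀-complete (_⊕_ {u = 0 ∷ _} {_ ∷ _} d e) eq = D₀-complete d refl ⊕ D₀-complete e eq
D₀-complete [] eq = []
D₀-complete (_∷_ {u = 0 ∷ _} {_ ∷ _} d e) eq = D₀-complete d refl ∷ D₀-complete e eq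

-- { c ∷ v ∣ suc c ∷ v ∈ E }
D₁ : ∀ {r} → Exp 0 (suc r) → Exp 0 (suc r)
D₁ ∅                  = ∅
D₁ (sing (0 ∷ w))     = ∅
D₁ (sing (suc c ∷ w)) = sing (c ∷ w)
D₁ (E ∪ F)            = D₁ E ∪ D₁ F
D₁ (E ⊕ F)            = D₁ E ⊕ F ∪ E ⊕ D₁ F
D₁ (E ⋆)              = D₁ E ⊕ E ⋆

bump : ∀ {r} → Vec ℕ (suc r) → Vec ℕ (suc r)
bump (c ∷ v) = suc c ∷ v

bump-+ˡ : ∀ {r} (u v : Vec ℕ (suc r)) → bump u +ᵥ v ≡ bump (u +ᵥ v)
bump-+ˡ (_ ∷ _) (_ ∷ _) = refl

bump-+ʳ : ∀ {r} (u v : Vec ℕ (suc r)) → u +ᵥ bump v ≡ bump (u +ᵥ v)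
bump-+ʳ (a ∷ u) (b ∷ v) = cong (_∷ u +ᵥ v) (ℕ.+-suc a b)

D₁-sound : ∀ {r} (E : Exp 0 (suc r)) {w} → D₁ E ∋ w → E ∋ bump w
D₁-sound (sing (suc c ∷ w)) sing = sing
D₁-sound (E ∪ F) (inˡ d) = inˡ (D₁-sound E d)
D₁-sound (E ∪ F) (inʳ d) = inʳ (D₁-sound F d)
D₁-sound (E ⊕ F) (inˡ (_⊕_ {u = u} {v} d e)) = subst (_ ∋_) (bump-+ˡ u v) (D₁-sound E d ⊕ e)
D₁-sound (E ⊕ F) (inʳ (_⊕_ {u = u} {v} d e)) = subst (_ ∋_) (bump-+ʳ u v) (d ⊕ D₁-sound F e)
D₁-sound (E ⋆) (_⊕_ {u = u} {v} d e) = subst (_ ∋_) (bump-+ˡ u v) (D₁-sound E d ∷ e)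

-- By commutativity a factor in front of the differentiated one can be moved into the star behind
-- it. Hence `D₁ (E ⋆)` needs no star on the left.
absorb-⋆ : ∀ {k r} {ρ : Fin k → Exp k r} {E F u v} → ρ ⊢ E ∋ u → ρ ⊢ F ⊕ E ⋆ ∋ v → ρ ⊢ F ⊕ E ⋆ ∋ u +ᵥ v
absorb-⋆ {u = w} d (_⊕_ {u = u} {v} e f) =
  subst (_ ⊢ _ ∋_) (solve 3 (λ w u v → u S.⊕ (w S.⊕ v) ⊜ w S.⊕ (u S.⊕ v)) refl w u v) (e ⊕ (d ∷ f))

D₁-sing : ∀ {r c} (w : Vec ℕ (suc r)) → head w ≡ suc c → D₁ (sing w) ∋ c ∷ tail w
D₁-sing (suc c ∷ w) refl = sing

D₁-complete : ∀ {r} {E : Exp 0 (suc r)} {w c} → E ∋ w → head w ≡ suc c → D₁ E ∋ c ∷ tail w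
D₁-complete (sing {w}) eq = D₁-sing w eq
D₁-complete (inˡ d) eq = inˡ (D₁-complete d eq)
D₁-complete (inʳ d) eq = inʳ (D₁-complete d eq)
D₁-complete (_⊕_ {u = zero ∷ _} {_ ∷ _} d e) eq = inʳ (d ⊕ D₁-complete e eq)
D₁-complete (_⊕_ {u = suc a ∷ _} {_ ∷ _} d e) refl = inˡ (D₁-complete d refl ⊕ e)
D₁-complete (_∷_ {u = zero ∷ _} {_ ∷ _} d e) eq = absorb-⋆ d (D₁-complete e eq)
D₁-complete (_∷_ {u = suc a ∷ _} {_ ∷ _} d e) refl = D₁-complete d refl ⊕ e

pow : ∀ {r} → Exp 0 r → ℕ → Exp 0 r
pow S zero    = sing 0ᵥ
pow S (suc c) = S ⊕ pow S c

pow-sound : ∀ {r} {S : Exp 0 r} c {v} → pow S c ∋ v → Pow (S ∋_) c v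
pow-sound zero    sing    = []
pow-sound (suc c) (d ⊕ e) = d ∷ pow-sound c e

pow-complete : ∀ {r} {S : Exp 0 r} {c v} → Pow (S ∋_) c v → pow S c ∋ v
pow-complete []       = sing
pow-complete (p ∷ ps) = p ⊕ pow-complete ps

-- Substitutes S for the first terminal.
_◂_ : ∀ {r} → Exp 0 r → Exp 0 (suc r) → Exp 0 r
S ◂ ∅            = ∅
S ◂ sing (c ∷ w) = sing w ⊕ pow S c
S ◂ (E ∪ F)      = S ◂ E ∪ S ◂ F
S ◂ (E ⊕ F)      = S ◂ E ⊕ S ◂ F
S ◂ (E ⋆)          = (S ◂ E) ⋆

-- Substitution for the first terminal, each of its c copies being replaced by an element of `P` of
-- its own. As order does not matter, the sum `s` of the c replacements is all that has to be kept.
record Sub {k r} (ρ : Fin k → Exp k (suc r)) (E : Exp k (suc r)) (P : Vec ℕ r → Set) (v : Vec ℕ r) : Set where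
  constructor sub
  field
    {c}   : ℕ
    {u s} : Vec ℕ r
    word  : ρ ⊢ E ∋ c ∷ u
    parts : Pow P c s
    split : v ≡ u +ᵥ s

interchange : ∀ {r} (u s v t : Vec ℕ r) → (u +ᵥ s) +ᵥ (v +ᵥ t) ≡ (u +ᵥ v) +ᵥ (s +ᵥ t)
interchange = solve 4 (λ u s v t → (u S.⊕ s) S.⊕ (v S.⊕ t) ⊜ (u S.⊕ v) S.⊕ (s S.⊕ t)) refl

module _ {k r} {ρ : Fin k → Exp k (suc r)} {P : Vec ℕ r → Set} where

  Sub-map : ∀ {E F} → (∀ {w} → ρ ⊢ E ∋ w → ρ ⊢ F ∋ w) → ∀ {v} → Sub ρ E P v → Sub ρ F P v
  Sub-map f (sub d ps eq) = sub (f d) ps eq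

  Sub-+ : ∀ {E F G} → (∀ {u v} → ρ ⊢ E ∋ u → ρ ⊢ F ∋ v → ρ ⊢ G ∋ u +ᵥ v) →
          ∀ {u v} → Sub ρ E P u → Sub ρ F P v → Sub ρ G P (u +ᵥ v)
  Sub-+ f (sub {u = u} {s} d ps refl) (sub {u = u′} {s′} d′ ps′ refl) =
    sub (f d d′) (Pow-++ ps ps′) (interchange u s u′ s′)

  Sub-0 : ∀ {E v} → ρ ⊢ E ∋ 0 ∷ v → Sub ρ E P v
  Sub-0 {v = v} d = sub d [] (sym (+ᵥ.identityʳ v))

module _ {r} (S : Exp 0 r) where

  ◂-sound : ∀ E {v} → S ◂ E ∋ v → Sub noRules E (S ∋_) v
  ◂-sound (sing (c ∷ w)) (sing ⊕ d) = sub sing (pow-sound c d) refl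
  ◂-sound (E ∪ F) (inˡ d)  = Sub-map inˡ (◂-sound E d)
  ◂-sound (E ∪ F) (inʳ d)  = Sub-map inʳ (◂-sound F d)
  ◂-sound (E ⊕ F) (d ⊕ e)  = Sub-+ _⊕_ (◂-sound E d) (◂-sound F e)
  ◂-sound (E ⋆)   []       = Sub-0 []
  ◂-sound (E ⋆)   (d ∷ ds) = Sub-+ _∷_ (◂-sound E d) (◂-sound (E ⋆) ds)

  ◂-sing : ∀ w {s} → Pow (S ∋_) (head w) s → S ◂ sing w ∋ tail w +ᵥ s
  ◂-sing (c ∷ w) ps = sing ⊕ pow-complete ps

  ◂-complete′ : ∀ {E w s} → E ∋ w → Pow (S ∋_) (head w) s → S ◂ E ∋ tail w +ᵥ s
  ◂-complete′ (sing {w}) ps = ◂-sing w ps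
  ◂-complete′ (inˡ d) ps = inˡ (◂-complete′ d ps)
  ◂-complete′ (inʳ d) ps = inʳ (◂-complete′ d ps)
  ◂-complete′ (_⊕_ {u = a ∷ u} {_ ∷ v} d e) ps with s , s′ , qs , qs′ , refl ← Pow-split a ps =
    subst (_ ∋_) (interchange u s v s′) (◂-complete′ d qs ⊕ ◂-complete′ e qs′)
  ◂-complete′ {E ⋆} [] [] = subst (S ◂ (E ⋆) ∋_) (sym (+ᵥ.identityʳ 0ᵥ)) []
  ◂-complete′ (_∷_ {u = a ∷ u} {_ ∷ v} d e) ps with s , s′ , qs , qs′ , refl ← Pow-split a ps =
    subst (_ ∋_) (interchange u s v s′) (◂-complete′ d qs ∷ ◂-complete′ e qs′)

  ◂-complete : ∀ {E v} → Sub noRules E (S ∋_) v → S ◂ E ∋ v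
  ◂-complete (sub d ps refl) = ◂-complete′ d ps

-- Makes nonterminal 0 the first terminal.
lift : ∀ {k r} → Exp (suc k) r → Exp k (suc r)
lift ∅            = ∅
lift (sing w)     = sing (0 ∷ w)
lift (nt zero)    = sing (1 ∷ 0ᵥ)
lift (nt (suc A)) = nt A
lift (E ∪ F)      = lift E ∪ lift F
lift (E ⊕ F)      = lift E ⊕ lift F
lift (E ⋆)        = lift E ⋆

-- The least solution of X = E[X], using E[X] = D₀ E + X D₁ E[X].
fix : ∀ {r} → Exp 0 (suc r) → Exp 0 r
fix E = D₀ E ⊕ (D₀ E ◂ D₁ E) ⋆

-- Commutativity merges the star factors of c solutions into a single one.
fix-pow : ∀ {r} (E : Exp 0 (suc r)) {c s} → Pow (fix E ∋_) c s →
          ∃[ d ] ∃[ m ] Pow (D₀ E ∋_) c d × (D₀ E ◂ D₁ E) ⋆ ∋ m × s ≡ d +ᵥ m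
fix-pow E [] = 0ᵥ , 0ᵥ , [] , [] , sym (+ᵥ.identityʳ 0ᵥ)
fix-pow E ((_⊕_ {u = u} {v} x m) ∷ ps) with d , m′ , ds , ms , refl ← fix-pow E ps =
  u +ᵥ d , v +ᵥ m′ , x ∷ ds , ⋆-++ m ms , interchange u v d m′

-- Write A for `D₀ E` and B for `D₁ E`. Of c + 1 elements of A B(A)* put for the unknown, one
-- supplies the leading factor A, the A-parts of the other c turn the derivative into an element of
-- B(A), and all stars merge.
fix-closed : ∀ {r} (E : Exp 0 (suc r)) {v} → Sub noRules E (fix E ∋_) v → fix E ∋ v
fix-closed E (sub {zero} d [] refl) = D₀-complete d refl ⊕ []
fix-closed E (sub {suc c} {u} d ps refl) with fix-pow E ps
... | _ , m , _∷_ {u = x} {y} p ds , ms , refl =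
  subst (fix E ∋_)
    (solve 4 (λ x u y m → x S.⊕ ((u S.⊕ y) S.⊕ m) ⊜ u S.⊕ ((x S.⊕ y) S.⊕ m)) refl x u y m)
    (p ⊕ (◂-complete (D₀ E) (sub (D₁-complete d refl) ds refl) ∷ ms))

-- Gaussian elimination for fixed points (Bekić's principle): the other nonterminals are eliminated
-- with nonterminal 0 as a parameter, the remaining equation in one unknown is solved by `fix`, and
-- the solution is substituted.
eliminate : ∀ k {r} → (Fin k → Exp k r) → Exp k r → Exp 0 r
eliminate zero    ρ E = E
eliminate (suc k) ρ E = fix (eliminate k ρ′ (lift (ρ zero))) ◂ eliminate k ρ′ (lift E)
  where ρ′ = lift ∘ ρ ∘ suc

fold-lift : ∀ {k r} {ρ : Fin (suc k) → Exp (suc k) r} E {w s} → (lift ∘ ρ ∘ suc) ⊢ lift E ∋ w →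
            Pow (ρ ⊢ nt zero ∋_) (head w) s → ρ ⊢ E ∋ tail w +ᵥ s
fold-lift (sing w)     sing    [] = subst (_ ⊢ sing w ∋_) (sym (+ᵥ.identityʳ w)) sing
fold-lift (nt zero)    sing    (_∷_ {u = u} p []) =
  subst (_ ⊢ nt zero ∋_) (solve 1 (λ u → u ⊜ S.id S.⊕ (u S.⊕ S.id)) refl u) p
fold-lift {ρ = ρ} (nt (suc A)) (nt d)  ps = nt (fold-lift (ρ (suc A)) d ps)
fold-lift (E ∪ F)      (inˡ d) ps = inˡ (fold-lift E d ps)
fold-lift (E ∪ F)      (inʳ d) ps = inʳ (fold-lift F d ps)
fold-lift (E ⊕ F) (_⊕_ {u = a ∷ u} {_ ∷ v} d e) ps with s , s′ , qs , qs′ , refl ← Pow-split a ps =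
  subst (_ ⊢ E ⊕ F ∋_) (interchange u s v s′) (fold-lift E d qs ⊕ fold-lift F e qs′)
fold-lift (E ⋆) [] [] = subst (_ ⊢ E ⋆ ∋_) (sym (+ᵥ.identityʳ 0ᵥ)) []
fold-lift (E ⋆) (_∷_ {u = a ∷ u} {_ ∷ v} d e) ps with s , s′ , qs , qs′ , refl ← Pow-split a ps =
  subst (_ ⊢ E ⋆ ∋_) (interchange u s v s′) (fold-lift E d qs ∷ fold-lift (E ⋆) e qs′)

eliminate-complete : ∀ k {r} {ρ : Fin k → Exp k r} {E v} → ρ ⊢ E ∋ v → eliminate k ρ E ∋ v
eliminate-complete zero d = closed d
eliminate-complete (suc k) {ρ = ρ} d = ◂-complete X (eliminate′ (unfold d))
  where
  ρ′ = lift ∘ ρ ∘ suc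
  EX = eliminate k ρ′ (lift (ρ zero))
  X = fix EX
  eliminate′ : ∀ {E v} → Sub ρ′ (lift E) (X ∋_) v → Sub noRules (eliminate k ρ′ (lift E)) (X ∋_) v
  eliminate′ (sub d ps eq) = sub (eliminate-complete k d) ps eq
  unfold : ∀ {E v} → ρ ⊢ E ∋ v → Sub ρ′ (lift E) (X ∋_) v
  unfold sing = Sub-0 sing
  -- This use of nonterminal 0 becomes one copy of the new terminal. Its own derivation is already
  -- unfolded, so closure of `X` under its equation puts the yield `v` into `X`.
  unfold (nt {zero} {v} d) = sub sing (fix-closed EX (eliminate′ {ρ zero} (unfold d)) ∷ [])
    (solve 1 (λ u → u ⊜ S.id S.⊕ (u S.⊕ S.id)) refl v)
  unfold (nt {suc A} d) = Sub-map nt (unfold d)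
  unfold (inˡ d)  = Sub-map inˡ (unfold d)
  unfold (inʳ d)  = Sub-map inʳ (unfold d)
  unfold (d ⊕ e)  = Sub-+ _⊕_ (unfold d) (unfold e)
  unfold []       = Sub-0 []
  unfold (d ∷ ds) = Sub-+ _∷_ (unfold d) (unfold ds)

eliminate-sound : ∀ k {r} {ρ : Fin k → Exp k r} E {v} → eliminate k ρ E ∋ v → ρ ⊢ E ∋ v
eliminate-sound zero E d = closed d
eliminate-sound (suc k) {ρ = ρ} E d with ◂-sound _ _ d
... | sub {s = s} d′ ps refl = fold-lift E (eliminate-sound k (lift E) d′) (Pow-map fix-sound ps)
  where
  ρ′ = lift ∘ ρ ∘ suc
  EX = eliminate k ρ′ (lift (ρ zero))
  X-sound : ∀ {w s} → EX ∋ w → Pow (ρ ⊢ nt zero ∋_) (head w) s → ρ ⊢ nt zero ∋ tail w +ᵥ s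
  X-sound d ps = nt (fold-lift (ρ zero) (eliminate-sound k (lift (ρ zero)) d) ps)
  D₀-sound′ : ∀ {x} → D₀ EX ∋ x → ρ ⊢ nt zero ∋ x
  D₀-sound′ {x} d = subst (_ ⊢ _ ∋_) (+ᵥ.identityʳ x) (X-sound (D₀-sound EX d) [])
  -- The element `x +ᵥ m` obtained so far takes the place of the copy of the unknown that `D₁`
  -- removed; elements of `D₀ EX` take the places of the other copies.
  star-sound : ∀ {x m} → D₀ EX ∋ x → (D₀ EX ◂ D₁ EX) ⋆ ∋ m → ρ ⊢ nt zero ∋ x +ᵥ m
  star-sound {x} d [] = subst (_ ⊢ _ ∋_) (sym (+ᵥ.identityʳ x)) (D₀-sound′ d)
  star-sound {x} d (_∷_ {v = m} e es) with ◂-sound (D₀ EX) (D₁ EX) e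
  ... | sub {u = u} {s} f ps refl = subst (_ ⊢ _ ∋_)
    (solve 4 (λ u x m s → u S.⊕ ((x S.⊕ m) S.⊕ s) ⊜ x S.⊕ ((u S.⊕ s) S.⊕ m)) refl u x m s)
    (X-sound (D₁-sound EX f) (star-sound d es ∷ Pow-map D₀-sound′ ps))
  fix-sound : ∀ {v} → fix EX ∋ v → ρ ⊢ nt zero ∋ v
  fix-sound (d ⊕ e) = star-sound d e

-- Semilinear sets

module M {r} = Mult (+ᵥ.monoid {r})
open M using () renaming (_×_ to infixr 8 _·_)

Span : ∀ {r} → List (Vec ℕ r) → Vec ℕ r → Set
Span []       v = v ≡ 0ᵥ
Span (p ∷ ps) v = ∃[ l ] ∃[ w ] Span ps w × v ≡ l · p +ᵥ w

LinearSet : ℕ → Set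
LinearSet r = Vec ℕ r × List (Vec ℕ r)

Linear : ∀ {r} → Vec ℕ r → LinearSet r → Set
Linear v (b , ps) = ∃[ w ] Span ps w × v ≡ b +ᵥ w

Semilinear : ∀ {r} → List (LinearSet r) → Vec ℕ r → Set
Semilinear L v = Any (Linear v) L

Span-+ : ∀ {r} (ps : List (Vec ℕ r)) {u v} → Span ps u → Span ps v → Span ps (u +ᵥ v)
Span-+ []       refl refl = +ᵥ.identityʳ 0ᵥ
Span-+ (p ∷ ps) (l , u , s , refl) (m , v , t , refl) =
  l ℕ.+ m , u +ᵥ v , Span-+ ps s t ,
  trans (interchange (l · p) u (m · p) v) (cong (_+ᵥ (u +ᵥ v)) (sym (M.×-homo-+ p l m)))

Span-++⁺ : ∀ {r} (ps qs : List (Vec ℕ r)) {u v} → Span ps u → Span qs v → Span (ps List.++ qs) (u +ᵥ v)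
Span-++⁺ [] qs {v = v} refl t = subst (Span qs) (sym (+ᵥ.identityˡ v)) t
Span-++⁺ (p ∷ ps) qs {v = v} (l , w , s , refl) t =
  l , w +ᵥ v , Span-++⁺ ps qs s t , +ᵥ.assoc (l · p) w v

Span-++⁻ : ∀ {r} (ps qs : List (Vec ℕ r)) {v} → Span (ps List.++ qs) v →
           ∃[ s ] ∃[ t ] Span ps s × Span qs t × v ≡ s +ᵥ t
Span-++⁻ [] qs {v} t = 0ᵥ , v , refl , t , sym (+ᵥ.identityˡ v)
Span-++⁻ (p ∷ ps) qs (l , w , s , refl) with s , t , h , h′ , refl ← Span-++⁻ ps qs s =
  l · p +ᵥ s , t , (l , s , h , refl) , h′ , sym (+ᵥ.assoc (l · p) s t)

_⊹_ : ∀ {r} → LinearSet r → LinearSet r → LinearSet r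
(b , ps) ⊹ (c , qs) = b +ᵥ c , ps List.++ qs

_⊹⁺_ : ∀ {r} {x y : LinearSet r} {u v} → Linear u x → Linear v y → Linear (u +ᵥ v) (x ⊹ y)
_⊹⁺_ {x = b , ps} {c , qs} (s , h , refl) (t , h′ , refl) =
  s +ᵥ t , Span-++⁺ ps qs h h′ , interchange b s c t

⊹⁻ : ∀ {r} (x y : LinearSet r) {v} → Linear v (x ⊹ y) → ∃[ s ] ∃[ t ] Linear s x × Linear t y × v ≡ s +ᵥ t
⊹⁻ (b , ps) (c , qs) (w , h , refl) with s , t , h , h′ , refl ← Span-++⁻ ps qs h =
  b +ᵥ s , c +ᵥ t , (s , h , refl) , (t , h′ , refl) , interchange b c s t

_⊹⋆_ : ∀ {r} → List (LinearSet r) → List (LinearSet r) → List (LinearSet r)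
_⊹⋆_ = List.cartesianProductWith _⊹_

⊹⋆⁺ : ∀ {r} {L K : List (LinearSet r)} {u v} → Semilinear L u → Semilinear K v → Semilinear (L ⊹⋆ K) (u +ᵥ v)
⊹⋆⁺ = Any.cartesianProductWith⁺ _⊹_ _⊹⁺_

⊹⋆⁻ : ∀ {r} (L K : List (LinearSet r)) {v} → Semilinear (L ⊹⋆ K) v →
      ∃[ s ] ∃[ t ] Semilinear L s × Semilinear K t × v ≡ s +ᵥ t
⊹⋆⁻ L K p with z , z∈ , h ← find p with x , y , x∈ , y∈ , refl ← ∈-cartesianProductWith⁻ _⊹_ L K z∈
  with s , t , h₁ , h₂ , eq ← ⊹⁻ x y h = s , t , lose x∈ h₁ , lose y∈ h₂ , eq

-- {b + Σ ps}* is {0} together with b + {b , ps}*.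
star₁ : ∀ {r} → LinearSet r → List (LinearSet r)
star₁ (b , ps) = (0ᵥ , []) ∷ (b , b ∷ ps) ∷ []

-- In a commutative monoid (A ∪ B)* = A* + B*, so the stars of the members can be added.
star : ∀ {r} → List (LinearSet r) → List (LinearSet r)
star []      = (0ᵥ , []) ∷ []
star (x ∷ L) = star₁ x ⊹⋆ star L

star₁-absorb : ∀ {r} (x : LinearSet r) {u v} → Linear u x → Semilinear (star₁ x) v → Semilinear (star₁ x) (u +ᵥ v)
star₁-absorb (b , ps) (s , h , refl) (here (_ , refl , refl)) =
  there (here (s , (0 , s , h , sym (+ᵥ.identityˡ s)) ,
    solve 2 (λ b s → (b S.⊕ s) S.⊕ (S.id S.⊕ S.id) ⊜ b S.⊕ s) refl b s))
star₁-absorb (b , ps) (s , h , refl) (there (here (_ , (l , t , h′ , refl) , refl))) =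
  there (here (_ , (suc l , s +ᵥ t , Span-+ ps h h′ , refl) ,
    solve 4 (λ b s l t → (b S.⊕ s) S.⊕ (b S.⊕ (l S.⊕ t)) ⊜ b S.⊕ ((b S.⊕ l) S.⊕ (s S.⊕ t))) refl b s (l · b) t))

star-0 : ∀ {r} (L : List (LinearSet r)) → Semilinear (star L) 0ᵥ
star-0 []      = here (0ᵥ , refl , sym (+ᵥ.identityʳ 0ᵥ))
star-0 (x ∷ L) = subst (Semilinear (star (x ∷ L))) (+ᵥ.identityʳ 0ᵥ)
  (⊹⋆⁺ {L = star₁ x} (here (0ᵥ , refl , sym (+ᵥ.identityʳ 0ᵥ))) (star-0 L))

star-absorb : ∀ {r} (L : List (LinearSet r)) {u v} → Semilinear L u → Semilinear (star L) v → Semilinear (star L) (u +ᵥ v)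
star-absorb (x ∷ L) {u} p q with s , t , p₁ , p₂ , refl ← ⊹⋆⁻ (star₁ x) (star L) q with p
... | here h = subst (Semilinear (star (x ∷ L))) (+ᵥ.assoc u s t) (⊹⋆⁺ (star₁-absorb x h p₁) p₂)
... | there h = subst (Semilinear (star (x ∷ L)))
  (solve 3 (λ u s t → s S.⊕ (u S.⊕ t) ⊜ u S.⊕ (s S.⊕ t)) refl u s t) (⊹⋆⁺ p₁ (star-absorb L h p₂))

-- A nonzero choice b + (l b + w) from `star₁` splits into the one element b + w and l copies of b,
-- each of which is an element with all coefficients zero.
star-least : ∀ {r} (C : Vec ℕ r → Set) (L : List (LinearSet r)) → C 0ᵥ →
             (∀ {u v} → Semilinear L u → C v → C (u +ᵥ v)) → ∀ {v} → Semilinear (star L) v → C v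
star-least C []      c₀ c₊ (here (_ , refl , refl)) = subst C (sym (+ᵥ.identityʳ 0ᵥ)) c₀
star-least C (x@(b , ps) ∷ L) c₀ c₊ p with s , t , p₁ , p₂ , refl ← ⊹⋆⁻ (star₁ x) (star L) p = go p₁
  where
  ct : C t
  ct = star-least C L c₀ (c₊ ∘ there) p₂
  repeat : ∀ l {v} → C v → C (l · b +ᵥ v)
  repeat zero    {v} c = subst C (sym (+ᵥ.identityˡ v)) c
  repeat (suc l) {v} c = subst C (sym (+ᵥ.assoc b (l · b) v))
    (subst (λ z → C (z +ᵥ (l · b +ᵥ v))) (+ᵥ.identityʳ b)
      (c₊ (here (0ᵥ , 0-span ps , refl)) (repeat l c)))
    where
    0-span : ∀ ps → Span ps 0ᵥ
    0-span []       = refl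
    0-span (p ∷ ps) = 0 , 0ᵥ , 0-span ps , sym (+ᵥ.identityʳ 0ᵥ)
  go : ∀ {s} → Semilinear (star₁ x) s → C (s +ᵥ t)
  go (here (_ , refl , refl)) = subst C (solve 1 (λ t → t ⊜ (S.id S.⊕ S.id) S.⊕ t) refl t) ct
  go (there (here (_ , (l , w , h , refl) , refl))) =
    subst C (solve 4 (λ b l w t → l S.⊕ ((b S.⊕ w) S.⊕ t) ⊜ (b S.⊕ (l S.⊕ w)) S.⊕ t) refl b (l · b) w t)
      (repeat l (c₊ (here (w , h , refl)) ct))

nf : ∀ {r} → Exp 0 r → List (LinearSet r)
nf ∅        = []
nf (sing w) = (w , []) ∷ []
nf (E ∪ F)  = nf E List.++ nf F
nf (E ⊕ F)  = nf E ⊹⋆ nf F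
nf (E ⋆)    = star (nf E)

nf-complete : ∀ {r} {E : Exp 0 r} {v} → E ∋ v → Semilinear (nf E) v
nf-complete (sing {w}) = here (0ᵥ , refl , sym (+ᵥ.identityʳ w))
nf-complete (inˡ d)    = Any.++⁺ˡ (nf-complete d)
nf-complete (inʳ {E = E} d) = Any.++⁺ʳ (nf E) (nf-complete d)
nf-complete (d ⊕ e)    = ⊹⋆⁺ (nf-complete d) (nf-complete e)
nf-complete ([] {E})   = star-0 (nf E)
nf-complete (d ∷ e)    = star-absorb _ (nf-complete d) (nf-complete e)

nf-sound : ∀ {r} (E : Exp 0 r) {v} → Semilinear (nf E) v → E ∋ v
nf-sound (sing w) (here (_ , refl , refl)) = subst (sing w ∋_) (sym (+ᵥ.identityʳ w)) sing
nf-sound (E ∪ F) p with Any.++⁻ (nf E) p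
... | inj₁ q = inˡ (nf-sound E q)
... | inj₂ q = inʳ (nf-sound F q)
nf-sound (E ⊕ F) p with s , t , q , q′ , refl ← ⊹⋆⁻ (nf E) (nf F) p = nf-sound E q ⊕ nf-sound F q′
nf-sound (E ⋆) p = star-least (E ⋆ ∋_) (nf E) [] (λ q → nf-sound E q ∷_) p

opaque
  parikhImage : ∀ {k r} (ρ : Fin k → Exp k r) → Exp k r → List (LinearSet r)
  parikhImage ρ E = nf (eliminate _ ρ E)

  parikh : ∀ {k r} (ρ : Fin k → Exp k r) E v → (ρ ⊢ E ∋ v) ⇔ Semilinear (parikhImage ρ E) v
  parikh ρ E v = mk⇔ (nf-complete ∘ eliminate-complete _) (eliminate-sound _ E ∘ nf-sound (eliminate _ ρ E))

-- Models of grammars, and the product of a groupoid with an automaton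

data Star {r} (P : Vec ℕ r → Set) : Vec ℕ r → Set where
  []  : Star P 0ᵥ
  _∷_ : ∀ {u v} → P u → Star P v → Star P (u +ᵥ v)

Sem : ∀ {k r} → (Fin k → Vec ℕ r → Set) → Exp k r → Vec ℕ r → Set
Sem I ∅        v = ⊥
Sem I (sing w) v = v ≡ w
Sem I (nt A)   v = I A v
Sem I (E ∪ F)  v = Sem I E v ⊎ Sem I F v
Sem I (E ⊕ F)  v = ∃[ s ] ∃[ t ] Sem I E s × Sem I F t × v ≡ s +ᵥ t
Sem I (E ⋆)    v = Star (Sem I E) v

-- Soundness of a grammar reduces to this: it suffices to check the intended meaning of the
-- nonterminals rule by rule, without induction on derivations.
least-model : ∀ {k r} {ρ : Fin k → Exp k r} (I : Fin k → Vec ℕ r → Set) →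
              (∀ A {v} → Sem I (ρ A) v → I A v) → ∀ {E v} → ρ ⊢ E ∋ v → Sem I E v
least-model I c sing     = refl
least-model I c (nt {A} d) = c A (least-model I c d)
least-model I c (inˡ d)  = inj₁ (least-model I c d)
least-model I c (inʳ d)  = inj₂ (least-model I c d)
least-model I c (d ⊕ e)  = _ , _ , least-model I c d , least-model I c e , refl
least-model I c []       = []
least-model I c (d ∷ ds) = least-model I c d ∷ least-model I c ds

⋃ : ∀ {k r} n → (Fin n → Exp k r) → Exp k r
⋃ zero    E = ∅
⋃ (suc n) E = E zero ∪ ⋃ n (E ∘ suc)

in-⋃ : ∀ {k r} {ρ : Fin k → Exp k r} {n} (E : Fin n → Exp k r) i {v} → ρ ⊢ E i ∋ v → ρ ⊢ ⋃ n E ∋ v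
in-⋃ E zero    d = inˡ d
in-⋃ E (suc i) d = inʳ (in-⋃ (E ∘ suc) i d)

Sem-⋃ : ∀ {k r} {I : Fin k → Vec ℕ r → Set} n (E : Fin n → Exp k r) {v} →
        Sem I (⋃ n E) v → ∃[ i ] Sem I (E i) v
Sem-⋃ (suc n) E (inj₁ s) = zero , s
Sem-⋃ (suc n) E (inj₂ s) with i , t ← Sem-⋃ n (E ∘ suc) s = suc i , t

guard : ∀ {k r} {P : Set} → Dec P → Exp k r → Exp k r
guard (yes _) E = E
guard (no _)  E = ∅

in-guard : ∀ {k r} {ρ : Fin k → Exp k r} {P : Set} (P? : Dec P) {E v} → P → ρ ⊢ E ∋ v → ρ ⊢ guard P? E ∋ v
in-guard (yes _) p d = d
in-guard (no ¬p) p d = contradiction p ¬p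

Sem-guard : ∀ {k r} {I : Fin k → Vec ℕ r → Set} {P : Set} (P? : Dec P) {E v} → Sem I (guard P? E) v → P × Sem I E v
Sem-guard (yes p) s = p , s

-- The grammar of triples (p , a , q): the words that lead the automaton from p to q and evaluate to a.
module Triples {t s r} (G : Groupoid t) {Q : Set} (code : Q → Fin s) (decode : Fin s → Q)
  (decode-code : ∀ q → decode (code q) ≡ q)
  (Step : Q → Fin t → Q → Set) (step? : ∀ p a q → Dec (Step p a q)) (weight : Q → Vec ℕ r) where

  open Groupoid G

  data Path : Q → List (Fin t) → Vec ℕ r → Q → Set where
    []  : ∀ {p} → Path p [] 0ᵥ p
    _∷_ : ∀ {p a q u v q′} → Step p a q → Path q u v q′ → Path p (a ∷ u) (weight q +ᵥ v) q′

  Path-++ : ∀ {p q q′ u u′ v v′} → Path p u v q → Path q u′ v′ q′ → Path p (u List.++ u′) (v +ᵥ v′) q′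
  Path-++ {v′ = v′} [] π = subst (λ v → Path _ _ v _) (sym (+ᵥ.identityˡ v′)) π
  Path-++ {v′ = v′} (_∷_ {q = q} {v = v} st π) π′ =
    subst (λ v → Path _ _ v _) (sym (+ᵥ.assoc (weight q) v v′)) (st ∷ Path-++ π π′)

  Path-split : ∀ u {u′ p q w} → Path p (u List.++ u′) w q →
               ∃[ p′ ] ∃[ v ] ∃[ v′ ] Path p u v p′ × Path p′ u′ v′ q × w ≡ v +ᵥ v′
  Path-split [] {w = w} π = _ , 0ᵥ , w , [] , π , sym (+ᵥ.identityˡ w)
  Path-split (a ∷ u) (_∷_ {q = q} st π) with p′ , v , v′ , π₁ , π₂ , refl ← Path-split u π =
    p′ , weight q +ᵥ v , v′ , st ∷ π₁ , π₂ , sym (+ᵥ.assoc (weight q) v v′)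

  opaque
    nonterminals : ℕ
    nonterminals = s ℕ.* (t ℕ.* s)

    ⟨_,_,_⟩ : Q → Fin t → Q → Fin nonterminals
    ⟨ p , a , q ⟩ = combine (code p) (combine a (code q))

    pair : Fin (t ℕ.* s) → Fin t × Q
    pair x = map₂ decode (remQuot s x)

    triple : Fin nonterminals → Q × Fin t × Q
    triple A = Product.map decode pair (remQuot (t ℕ.* s) A)

    triple-⟨⟩ : ∀ p a q → triple ⟨ p , a , q ⟩ ≡ (p , a , q)
    triple-⟨⟩ p a q = trans (cong (Product.map decode pair) (Fin.remQuot-combine (code p) (combine a (code q))))
      (cong₂ _,_ (decode-code p)
        (trans (cong (map₂ decode) (Fin.remQuot-combine a (code q))) (cong (a ,_) (decode-code q))))

    -- The Bar-Hillel construction for intersecting a context-free with a regular language: either a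
    -- single letter is read, or the word is cut at a guessed state `p′` into factors with values b
    -- and c.
    rule : Q × Fin t × Q → Exp nonterminals r
    rule (p , a , q) = guard (step? p a q) (sing (weight q)) ∪
      ⋃ s λ p′ → ⋃ t λ b → ⋃ t λ c → guard (op b c Fin.≟ a) (nt ⟨ p , b , decode p′ ⟩ ⊕ nt ⟨ decode p′ , c , q ⟩)

    rules : Fin nonterminals → Exp nonterminals r
    rules A = rule (triple A)

    Yield : Q × Fin t × Q → Vec ℕ r → Set
    Yield (p , a , q) v = ∃[ u ] Path p u v q × Evaluates G u a

    rule-sound : ∀ x {v} → Sem (Yield ∘ triple) (rule x) v → Yield x v
    rule-sound (p , a , q) (inj₁ s) with st , refl ← Sem-guard (step? p a q) s =
      a ∷ [] , subst (λ v → Path p _ v q) (+ᵥ.identityʳ (weight q)) (st ∷ []) , leaf a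
    rule-sound (p , a , q) (inj₂ s₀)
      with p′ , s₁ ← Sem-⋃ s _ s₀ with b , s₂ ← Sem-⋃ t _ s₁ with c , s₃ ← Sem-⋃ t _ s₂
      with refl , v₁ , v₂ , y₁ , y₂ , refl ← Sem-guard (op b c Fin.≟ a) s₃
      with u₁ , π₁ , e₁ ← subst (λ x → Yield x v₁) (triple-⟨⟩ p b (decode p′)) y₁
         | u₂ , π₂ , e₂ ← subst (λ x → Yield x v₂) (triple-⟨⟩ (decode p′) c q) y₂
      = u₁ List.++ u₂ , Path-++ π₁ π₂ , node e₁ e₂

    sound : ∀ {p a q v} → rules ⊢ nt ⟨ p , a , q ⟩ ∋ v → ∃[ u ] Path p u v q × Evaluates G u a
    sound {p} {a} {q} {v} d =
      subst (λ x → Yield x v) (triple-⟨⟩ p a q) (least-model (Yield ∘ triple) (rule-sound ∘ triple) d)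

    apply-rule : ∀ p a q {v} → rules ⊢ rule (p , a , q) ∋ v → rules ⊢ nt ⟨ p , a , q ⟩ ∋ v
    apply-rule p a q {v} d = nt (subst (λ x → rules ⊢ rule x ∋ v) (sym (triple-⟨⟩ p a q)) d)

    complete : ∀ {p u v q a} → Evaluates G u a → Path p u v q → rules ⊢ nt ⟨ p , a , q ⟩ ∋ v
    complete {p} {q = q} (leaf a) (st ∷ []) = apply-rule p a q
      (inˡ (in-guard (step? p a q) st (subst (_ ⊢ _ ∋_) (sym (+ᵥ.identityʳ (weight q))) sing)))
    complete {p} {q = q} (node {u} {a = b} {b = c} e₁ e₂) π
      with p′ , v₁ , v₂ , π₁ , π₂ , refl ← Path-split u π = apply-rule p (op b c) q
        (inʳ (in-⋃ _ (code p′) (in-⋃ _ b (in-⋃ _ c (in-guard (op b c Fin.≟ op b c) refl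
          (subst (λ z → rules ⊢ nt ⟨ p , b , z ⟩ ∋ v₁) (sym (decode-code p′)) (complete e₁ π₁) ⊕
           subst (λ z → rules ⊢ nt ⟨ z , c , q ⟩ ∋ v₂) (sym (decode-code p′)) (complete e₂ π₂)))))))

-- Words composed of periodic blocks

-- InBlock ls j x: position x lies in the j-th of consecutive blocks of lengths ls.
InBlock : ∀ {r} → Vec ℕ r → Fin r → ℕ → Set
InBlock (l ∷ ls) zero    x = x ℕ.< l
InBlock (l ∷ ls) (suc j) x = l ℕ.≤ x × InBlock ls j (x ℕ.∸ l)

unit : ∀ {r} → Fin r → Vec ℕ r
unit zero    = 1 ∷ 0ᵥ
unit (suc j) = 0 ∷ unit j

-- Blocks never decrease along a path, so a path that starts in block j contributes nothing to
-- earlier ones.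
ZeroBelow : ∀ {r} → Fin r → Vec ℕ r → Set
ZeroBelow zero    w        = ⊤
ZeroBelow (suc j) (l ∷ ls) = l ≡ 0 × ZeroBelow j ls

ZeroBelow-0 : ∀ {r} (j : Fin r) → ZeroBelow j 0ᵥ
ZeroBelow-0 zero    = tt
ZeroBelow-0 (suc j) = refl , ZeroBelow-0 j

ZeroBelow-unit : ∀ {r} (i j : Fin r) w → i Fin.≤ j → ZeroBelow j w → ZeroBelow i (unit j +ᵥ w)
ZeroBelow-unit zero    j       w        i≤j       z        = tt
ZeroBelow-unit (suc i) (suc j) (l ∷ w) (s≤s i≤j) (eq , z) = eq , ZeroBelow-unit i j w i≤j z

¬InBlock-0 : ∀ {r} (j : Fin r) x → ¬ InBlock 0ᵥ j x
¬InBlock-0 (suc j) x (_ , b) = ¬InBlock-0 j x b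

-- As the blocks before j are empty, lengthening block j by one puts a new position in front of all
-- others; the next lemma says that the others are shifted by one.
InBlock-unit-zero : ∀ {r} (j : Fin r) w → ZeroBelow j w → ∀ i → InBlock (unit j +ᵥ w) i 0 ⇔ i ≡ j
InBlock-unit-zero zero (l ∷ w) z zero = mk⇔ (λ _ → refl) λ _ → s≤s z≤n
InBlock-unit-zero zero (l ∷ w) z (suc i) = mk⇔ (λ ()) λ ()
InBlock-unit-zero (suc j) (l ∷ w) (refl , z) zero = mk⇔ (λ ()) λ ()
InBlock-unit-zero (suc j) (l ∷ w) (refl , z) (suc i) = mk⇔
  (λ { (_ , b) → cong suc (to (InBlock-unit-zero j w z i) b) })
  (λ { refl → z≤n , from (InBlock-unit-zero j w z i) refl })

InBlock-unit-suc : ∀ {r} (j : Fin r) w → ZeroBelow j w → ∀ i x →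
                   InBlock (unit j +ᵥ w) i (suc x) ⇔ InBlock w i x
InBlock-unit-suc zero (l ∷ w) z zero x = mk⇔ ℕ.≤-pred s≤s
InBlock-unit-suc zero (l ∷ w) z (suc i) x rewrite +ᵥ.identityˡ w =
  mk⇔ (λ (p , b) → ℕ.≤-pred p , b) λ (p , b) → s≤s p , b
InBlock-unit-suc (suc j) (l ∷ w) (refl , z) zero x = mk⇔ (λ ()) λ ()
InBlock-unit-suc (suc j) (l ∷ w) (refl , z) (suc i) x =
  mk⇔ (λ (_ , b) → z≤n , to (InBlock-unit-suc j w z i x) b) λ (_ , b) → z≤n , from (InBlock-unit-suc j w z i x) b

sum-0 : ∀ r → sum (0ᵥ {r}) ≡ 0
sum-0 zero    = refl
sum-0 (suc r) = sum-0 r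

sum-unit : ∀ {r} (j : Fin r) w → sum (unit j +ᵥ w) ≡ suc (sum w)
sum-unit zero    (l ∷ w) rewrite +ᵥ.identityˡ w = refl
sum-unit (suc j) (l ∷ w) = trans (cong (l ℕ.+_) (sum-unit j w)) (ℕ.+-suc l (sum w))

toℕ-mod : ∀ x M .{{_ : NonZero M}} → toℕ (x mod M) ≡ x % M
toℕ-mod x M = Fin.toℕ-fromℕ< (m%n<n x M)

suc-mod : ∀ x M .{{_ : NonZero M}} → suc (toℕ (x mod M)) mod M ≡ suc x mod M
suc-mod x M = Fin.toℕ-injective (begin
  toℕ (suc (toℕ (x mod M)) mod M) ≡⟨ toℕ-mod (suc (toℕ (x mod M))) M ⟩
  suc (toℕ (x mod M)) % M         ≡⟨ cong (λ y → suc y % M) (toℕ-mod x M) ⟩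
  (1 ℕ.+ x % M) % M               ≡⟨ %-distribˡ-+ 1 (x % M) M ⟩
  (1 % M ℕ.+ x % M % M) % M       ≡⟨ cong (λ y → (1 % M ℕ.+ y) % M) (m%n%n≡m%n x M) ⟩
  (1 % M ℕ.+ x % M) % M           ≡⟨ %-distribˡ-+ 1 x M ⟨
  suc x % M                       ≡⟨ toℕ-mod (suc x) M ⟨
  toℕ (suc x mod M)               ∎)
  where open ≡-Reasoning

-- Words that in each block are periodic with period M: at a position x of block j the letter is
-- τ (combine j (x mod M)). A state records the block and the residue of the next position.
module Blocks {t} (G : Groupoid t) (R M : ℕ) .{{M≢0 : NonZero M}} (τ : Fin (R ℕ.* M) → Fin t) where

  State : Set
  State = Fin R × Fin M

  -- The letter takes its residue from the state left and its block from the state reached.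
  -- Weighting a step by the block reached therefore makes the total weight of a path the vector of
  -- block lengths, and blocks that are jumped over are empty.
  Step : State → Fin t → State → Set
  Step (i , ρ) a (j , ρ′) = i Fin.≤ j × ρ′ ≡ suc (toℕ ρ) mod M × a ≡ τ (combine j ρ)

  step? : ∀ p a q → Dec (Step p a q)
  step? (i , ρ) a (j , ρ′) = i Fin.≤? j ×-dec (ρ′ Fin.≟ suc (toℕ ρ) mod M) ×-dec (a Fin.≟ τ (combine j ρ))

  open Triples G (λ (i , ρ) → combine i ρ) (remQuot M) (λ (i , ρ) → Fin.remQuot-combine i ρ)
    Step step? (unit ∘ proj₁) public

  Path-zeros : ∀ {p u w q} → Path p u w q → ZeroBelow (proj₁ p) w
  Path-zeros {i , _} []                  = ZeroBelow-0 i
  Path-zeros {i , _} (_∷_ {q = j , _} (i≤j , _) π) = ZeroBelow-unit i j _ i≤j (Path-zeros π)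

  Path-length : ∀ {p u w q} → Path p u w q → sum w ≡ length u
  Path-length []                   = sum-0 R
  Path-length (_∷_ {q = j , _} _ π) = trans (sum-unit j _) (cong suc (Path-length π))

  -- The offset `s` allows induction along a path: `f` and `w` describe the rest of the word,
  -- whereas residues are still counted from the beginning of the whole word.
  Match : (ℕ → Fin t) → ℕ → Vec ℕ R → Set
  Match f s w = ∀ x j → InBlock w j x → f x ≡ τ (combine j ((s ℕ.+ x) mod M))

  -- Here the block lengths determine the word: each step forces the letter given by `τ`, which
  -- `Match` identifies with the value of `f`.
  path-word : ∀ {f i q} s {u w} → Path (i , s mod M) u w q → Match f s w → u ≡ applyUpTo f (length u)
  path-word s [] m = refl
  path-word {f} s (_∷_ {q = j , _} {v = v} (_ , refl , refl) π) m rewrite suc-mod s M {{M≢0}} = cong₂ _∷_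
    (sym (trans (m 0 j (from (InBlock-unit-zero j v z j) refl)) (cong (λ y → τ (combine j (y mod M))) (ℕ.+-identityʳ s))))
    (path-word (suc s) π λ x j′ b → trans (m (suc x) j′ (from (InBlock-unit-suc j v z j′ x) b))
      (cong (λ y → τ (combine j′ (y mod M))) (ℕ.+-suc s x)))
    where z = Path-zeros π

  word-match : ∀ {f i q} s k {w} → Path (i , s mod M) (applyUpTo f k) w q → Match f s w
  word-match s zero [] x j b = contradiction b (¬InBlock-0 j x)
  word-match s (suc k) (_∷_ {q = j , _} {v = v} (_ , refl , eq) π) zero j′ b
    with refl ← to (InBlock-unit-zero j v (Path-zeros π) j′) b =
    trans eq (cong (λ y → τ (combine j (y mod M))) (sym (ℕ.+-identityʳ s)))
  word-match s (suc k) (_∷_ {q = j , _} {v = v} (_ , refl , _) π) (suc x) j′ b rewrite suc-mod s M {{M≢0}} =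
    trans (word-match (suc s) k π x j′ (to (InBlock-unit-suc j v (Path-zeros π) j′ x) b))
      (cong (λ y → τ (combine j′ (y mod M))) (sym (ℕ.+-suc s x)))

  make-path : ∀ (κ : ℕ → Fin R) {f i} s → (∀ x → κ x Fin.≤ κ (suc x)) → i Fin.≤ κ 0 →
              ∀ k → (∀ x → x ℕ.< k → f x ≡ τ (combine (κ x) ((s ℕ.+ x) mod M))) →
              ∃[ w ] ∃[ q ] Path (i , s mod M) (applyUpTo f k) w q
  make-path κ s mono i≤ zero h = _ , _ , []
  make-path κ {f} s mono i≤ (suc k) h
    with w , q , π ← make-path (κ ∘ suc) {f ∘ suc} {κ 0} (suc s) (mono ∘ suc) (mono 0) k
           (λ x x<k → trans (h (suc x) (s≤s x<k)) (cong (λ y → τ (combine (κ (suc x)) (y mod M))) (ℕ.+-suc s x))) =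
    _ , q , (i≤ , sym (suc-mod s M) , trans (h 0 (s≤s z≤n)) (cong (λ y → τ (combine (κ 0) (y mod M))) (ℕ.+-identityʳ s))) ∷ π

-- Affine descriptions of linear sets

weaken : ∀ k {m} → Lin m → Lin (k ℕ.+ m)
weaken zero    t = t
weaken (suc k) t = 0ℤ ∷ weaken k t

val-weakens : ∀ {k m} (t : Lin m) (ls : Vec ℕ k) xs → val (weaken k t) (ls ++ xs) ≡ val t xs
val-weakens t []       xs = refl
val-weakens t (l ∷ ls) xs = trans (val-weaken (weaken _ t) l (ls ++ xs)) (val-weakens t ls xs)

weaken₁ : ∀ k {m} → Lin (suc m) → Lin (suc (k ℕ.+ m))
weaken₁ k (a ∷ t) = a ∷ weaken k t

val-weaken₁ : ∀ {k m} (ls : Vec ℕ k) x xs (t : Lin (suc m)) →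
              val (weaken₁ k t) (x ∷ ls ++ xs) ≡ val t (x ∷ xs)
val-weaken₁ ls x xs (a ∷ t) = cong (λ v → a ℤ.* + x ℤ.+ v) (val-weakens t ls xs)

Vals : ∀ {m r} → Vec ℕ m → Vec (Lin m) r → Vec ℕ r → Set
Vals xs = Pointwise (λ t a → val t xs ≡ + a)

comb : ∀ {r} → Vec ℕ r → (ps : List (Vec ℕ r)) → Vec ℕ (length ps) → Vec ℕ r
comb b []       []       = b
comb b (p ∷ ps) (l ∷ ls) = Vec.map (l ℕ.*_) p +ᵥ comb b ps ls

·-map : ∀ {r} l (p : Vec ℕ r) → l · p ≡ Vec.map (l ℕ.*_) p
·-map zero    []       = refl
·-map zero    (a ∷ p)  = cong (0 ∷_) (·-map zero p)
·-map (suc l) p rewrite ·-map l p = go p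
  where
  go : ∀ {r} (p : Vec ℕ r) → p +ᵥ Vec.map (l ℕ.*_) p ≡ Vec.map (suc l ℕ.*_) p
  go []      = refl
  go (a ∷ p) = cong (_ ∷_) (go p)

Linear⇔comb : ∀ {r} (b : Vec ℕ r) ps {v} → Linear v (b , ps) ⇔ (∃[ ls ] v ≡ comb b ps ls)
Linear⇔comb b ps = mk⇔
  (λ { (w , s , refl) → let (ls , eq) = span→ ps s in ls , trans (+ᵥ.comm b w) eq })
  λ { (ls , refl) → let (w , s , eq) = span← ps ls in w , s , eq }
  where
  span→ : ∀ ps {w} → Span ps w → ∃[ ls ] w +ᵥ b ≡ comb b ps ls
  span→ [] refl = [] , +ᵥ.identityˡ b
  span→ (p ∷ ps) (l , w , s , refl) with ls , eq ← span→ ps s =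
    l ∷ ls , trans (+ᵥ.assoc (l · p) w b) (cong₂ _+ᵥ_ (·-map l p) eq)
  span← : ∀ ps ls → Linear (comb b ps ls) (b , ps)
  span← [] [] = 0ᵥ , refl , sym (+ᵥ.identityʳ b)
  span← (p ∷ ps) (l ∷ ls) with w , s , eq ← span← ps ls =
    l · p +ᵥ w , (l , w , s , refl) ,
    trans (cong₂ _+ᵥ_ (sym (·-map l p)) eq)
      (S.solve 3 (λ l b w → l S.⊕ (b S.⊕ w) S.⊜ b S.⊕ (l S.⊕ w)) refl (l · p) b w)

-- The multiplicities of the periods become the first variables, so every component of a vector in
-- the linear set is an affine form in them.
coords : ∀ {m r} → Vec ℕ r → (ps : List (Vec ℕ r)) → Vec (Lin (length ps ℕ.+ m)) r
coords b []       = Vec.map (const ∘ +_) b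
coords b (p ∷ ps) = Vec.zipWith (λ c t → + c ∷ t) p (coords b ps)

Vals-coords : ∀ {m r} (b : Vec ℕ r) ps ls (xs : Vec ℕ m) → Vals (ls ++ xs) (coords b ps) (comb b ps ls)
Vals-coords b [] [] xs = consts b
  where
  consts : ∀ {r} (b : Vec ℕ r) → Vals xs (Vec.map (const ∘ +_) b) b
  consts []      = []
  consts (c ∷ b) = val-const (+ c) xs ∷ consts b
Vals-coords b (p ∷ ps) (l ∷ ls) xs = scaled p (Vals-coords b ps ls xs)
  where
  scaled : ∀ {r} (p : Vec ℕ r) {ts w} → Vals (ls ++ xs) ts w →
           Vals (l ∷ ls ++ xs) (Vec.zipWith (λ c t → + c ∷ t) p ts) (Vec.map (l ℕ.*_) p +ᵥ w)
  scaled []      []               = []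
  scaled (c ∷ p) (_∷_ {y = y} e es) =
    trans (cong₂ ℤ._+_ (trans (ℤ.*-comm (+ c) (+ l)) (sym (ℤ.pos-* l c))) e) (sym (ℤ.pos-+ (l ℕ.* c) y)) ∷ scaled p es

total : ∀ {m r} → Vec (Lin m) r → Lin m
total []       = const 0ℤ
total (t ∷ ts) = t ⊞ total ts

val-total : ∀ {m r} {xs : Vec ℕ m} {ts : Vec (Lin m) r} {w} → Vals xs ts w → val (total ts) xs ≡ + sum w
val-total {xs = xs} [] = val-const 0ℤ xs
val-total {xs = xs} (_∷_ {x = t} {xs = ts} e es) = trans (val-⊞ t (total ts) xs) (cong₂ ℤ._+_ e (val-total es))

_≐_ : ∀ {m} → Lin m → Lin m → QF m
s ≐ t = s ≤′ t ∧ t ≤′ s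

⟦≐⟧ : ∀ {m} (s t : Lin m) {xs a b} → val s xs ≡ + a → val t xs ≡ + b → ⟦ s ≐ t ⟧ xs ⇔ a ≡ b
⟦≐⟧ s t p q = mk⇔
  (λ (h , h′) → ℕ.≤-antisym (to (⟦≤′⟧ s t p q) h) (to (⟦≤′⟧ t s q p) h′))
  λ { refl → from (⟦≤′⟧ s t p q) ℕ.≤-refl , from (⟦≤′⟧ t s q p) ℕ.≤-refl }

suc′ : ∀ {m} → Lin m → Lin m
suc′ t = t ⊞ const 1ℤ

val-suc′ : ∀ {m} (t : Lin m) {xs a} → val t xs ≡ + a → val (suc′ t) xs ≡ + suc a
val-suc′ t {xs} {a} e = trans (val-⊞ t (const 1ℤ) xs)
  (trans (cong₂ ℤ._+_ e (val-const 1ℤ xs)) (cong +_ (ℕ.+-comm a 1)))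

-- The conjunct `l ≤′ x` also makes the integer difference x - l agree with the truncated one in
-- `InBlock`.
inBlock : ∀ {m r} → Lin m → Vec (Lin m) r → Fin r → QF m
inBlock x (l ∷ ls) zero    = suc′ x ≤′ l
inBlock x (l ∷ ls) (suc j) = l ≤′ x ∧ inBlock (x ⊞ -1ℤ ⊡ l) ls j

⟦inBlock⟧ : ∀ {m r} (x : Lin m) (ls : Vec (Lin m) r) j {xs a w} → val x xs ≡ + a → Vals xs ls w →
            ⟦ inBlock x ls j ⟧ xs ⇔ InBlock w j a
⟦inBlock⟧ x (l ∷ ls) zero    e (e′ ∷ _) = ⟦≤′⟧ (suc′ x) l (val-suc′ x e) e′
⟦inBlock⟧ x (l ∷ ls) (suc j) {xs} {a} {b ∷ w} e (e′ ∷ es) = mk⇔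
  (λ (p , q) → let b≤a = to (⟦≤′⟧ l x e′ e) p in b≤a , to (⟦inBlock⟧ _ ls j (diff b≤a) es) q)
  (λ (b≤a , q) → from (⟦≤′⟧ l x e′ e) b≤a , from (⟦inBlock⟧ _ ls j (diff b≤a) es) q)
  where
  ring : ∀ a b → a ℤ.+ -1ℤ ℤ.* b ≡ a ℤ.- b
  ring = solve-∀
  diff : b ℕ.≤ a → val (x ⊞ -1ℤ ⊡ l) xs ≡ + (a ℕ.∸ b)
  diff b≤a = trans (val-⊞ x (-1ℤ ⊡ l) xs) (trans (cong₂ ℤ._+_ e (trans (val-⊡ -1ℤ l xs) (cong (-1ℤ ℤ.*_) e′)))
    (trans (ring (+ a) (+ b)) (trans (ℤ.m-n≡m⊖n a b) (ℤ.⊖-≥ b≤a))))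

∸-mod⇒%≡ : ∀ M .{{_ : NonZero M}} {x y} → x ℕ.≤ y → y ≡ x [mod M ] → y % M ≡ x % M
∸-mod⇒%≡ M {x} {y} x≤y h
  with ℕ.divides k eq ← subst (M ℕ.∣_) (cong ℤ.∣_∣ (trans (ℤ.m-n≡m⊖n y x) (ℤ.⊖-≥ x≤y))) (∣⇒∣ᵤ h) =
  trans (cong (_% M) (trans (sym (ℕ.m+[n∸m]≡n x≤y)) (cong (x ℕ.+_) eq))) ([m+kn]%n≡m%n x k M)

≡mod⇒%≡ : ∀ M .{{_ : NonZero M}} x y → x ≡ y [mod M ] → x % M ≡ y % M
≡mod⇒%≡ M x y h with ℕ.≤-total x y
... | inj₁ x≤y = sym (∸-mod⇒%≡ M x≤y (≡mod-sym {x} {y} h))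
... | inj₂ y≤x = ∸-mod⇒%≡ M y≤x h

%≡⇒≡mod : ∀ M .{{_ : NonZero M}} x y → x % M ≡ y % M → x ≡ y [mod M ]
%≡⇒≡mod M x y h = divides (+ (x / M) ℤ.- + (y / M)) (begin
  + x ℤ.- + y ≡⟨ cong₂ ℤ._-_ (expand x) (expand y) ⟩
  (+ (x % M) ℤ.+ + (x / M) ℤ.* + M) ℤ.- (+ (y % M) ℤ.+ + (y / M) ℤ.* + M)
    ≡⟨ cong (λ z → (+ z ℤ.+ + (x / M) ℤ.* + M) ℤ.- (+ (y % M) ℤ.+ + (y / M) ℤ.* + M)) h ⟩
  (+ (y % M) ℤ.+ + (x / M) ℤ.* + M) ℤ.- (+ (y % M) ℤ.+ + (y / M) ℤ.* + M)
    ≡⟨ ring (+ (y % M)) (+ (x / M)) (+ (y / M)) (+ M) ⟩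
  (+ (x / M) ℤ.- + (y / M)) ℤ.* + M ∎)
  where
  open ≡-Reasoning
  expand : ∀ x → + x ≡ + (x % M) ℤ.+ + (x / M) ℤ.* + M
  expand x = trans (cong +_ (m≡m%n+[m/n]*n x M)) (cong (λ z → + (x % M) ℤ.+ z) (ℤ.pos-* (x / M) M))
  ring : ∀ r p q M → (r ℤ.+ p ℤ.* M) ℤ.- (r ℤ.+ q ℤ.* M) ≡ (p ℤ.- q) ℤ.* M
  ring = solve-∀

residue : ∀ {m} M → Fin M → QF (suc m)
residue M ρ = dvd (ℕ.pred M) (x[ zero ] ⊞ const (ℤ.- + toℕ ρ))

⟦residue⟧ : ∀ {m} M .{{_ : NonZero M}} ρ x (xs : Vec ℕ m) → ⟦ residue M ρ ⟧ (x ∷ xs) ⇔ x mod M ≡ ρ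
⟦residue⟧ M@(suc _) ρ x xs
  rewrite val-⊞ x[ zero ] (const (ℤ.- + toℕ ρ)) (x ∷ xs) | val-x zero (x ∷ xs) | val-const (ℤ.- + toℕ ρ) (x ∷ xs) = mk⇔
  (λ h → Fin.toℕ-injective (trans (toℕ-mod x M) (trans (≡mod⇒%≡ M x (toℕ ρ) h) small)))
  (λ h → %≡⇒≡mod M x (toℕ ρ) (trans (trans (sym (toℕ-mod x M)) (cong toℕ h)) (sym small)))
  where
  small : toℕ ρ % M ≡ toℕ ρ
  small = m<n⇒m%n≡m (Fin.toℕ<n ρ)

-- Piecewise periodicity

-- An indicator of the sign, oriented by the slope so that it can only rise from 0 to 1 as x grows.
-- It may be 1 already at x = 0.
change : ∀ {m} → Lin (suc m) → Vec ℕ m → ℕ → ℕ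
change t@(+ _ ∷ _) xs x with 0ℤ ℤ.≤? val t (x ∷ xs)
... | yes _ = 1
... | no _  = 0
change t@(-[1+ _ ] ∷ _) xs x with 0ℤ ℤ.≤? val t (x ∷ xs)
... | yes _ = 0
... | no _  = 1

change≤1 : ∀ {m} (t : Lin (suc m)) xs x → change t xs x ℕ.≤ 1
change≤1 t@(+ _ ∷ _) xs x with 0ℤ ℤ.≤? val t (x ∷ xs)
... | yes _ = ℕ.≤-refl
... | no _  = z≤n
change≤1 t@(-[1+ _ ] ∷ _) xs x with 0ℤ ℤ.≤? val t (x ∷ xs)
... | yes _ = z≤n
... | no _  = ℕ.≤-refl

change-mono : ∀ {m} (t : Lin (suc m)) xs {x y} → x ℕ.≤ y → change t xs x ℕ.≤ change t xs y
change-mono t@(+ a ∷ s) xs {x} {y} x≤y with 0ℤ ℤ.≤? val t (x ∷ xs) | 0ℤ ℤ.≤? val t (y ∷ xs)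
... | no _  | _     = z≤n
... | yes _ | yes _ = ℕ.≤-refl
... | yes p | no ¬q = contradiction
  (ℤ.≤-trans p (ℤ.+-monoˡ-≤ (val s xs) (ℤ.*-monoˡ-≤-nonNeg (+ a) (ℤ.+≤+ x≤y)))) ¬q
change-mono t@(-[1+ a ] ∷ s) xs {x} {y} x≤y with 0ℤ ℤ.≤? val t (x ∷ xs) | 0ℤ ℤ.≤? val t (y ∷ xs)
... | yes _ | _     = z≤n
... | no _  | no _  = ℕ.≤-refl
... | no ¬p | yes q = contradiction
  (ℤ.≤-trans q (ℤ.+-monoˡ-≤ (val s xs) (ℤ.*-monoˡ-≤-nonPos -[1+ a ] (ℤ.+≤+ x≤y)))) ¬p

change-sign : ∀ {m} (t : Lin (suc m)) xs {x y} → change t xs x ≡ change t xs y → SameSign xs x y t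
change-sign t@(+ _ ∷ _) xs {x} {y} eq with 0ℤ ℤ.≤? val t (x ∷ xs) | 0ℤ ℤ.≤? val t (y ∷ xs)
change-sign t@(+ _ ∷ _) xs eq | yes p | yes q = mk⇔ (λ _ → q) (λ _ → p)
change-sign t@(+ _ ∷ _) xs eq | no ¬p | no ¬q = mk⇔ (λ p → contradiction p ¬p) (λ q → contradiction q ¬q)
change-sign t@(-[1+ _ ] ∷ _) xs {x} {y} eq with 0ℤ ℤ.≤? val t (x ∷ xs) | 0ℤ ℤ.≤? val t (y ∷ xs)
change-sign t@(-[1+ _ ] ∷ _) xs eq | yes p | yes q = mk⇔ (λ _ → q) (λ _ → p)
change-sign t@(-[1+ _ ] ∷ _) xs eq | no ¬p | no ¬q = mk⇔ (λ p → contradiction p ¬p) (λ q → contradiction q ¬q)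

-- The number of atoms whose sign has changed before x.
changes : ∀ {m} → List (Lin (suc m)) → Vec ℕ m → ℕ → ℕ
changes []       xs x = 0
changes (t ∷ ts) xs x = change t xs x ℕ.+ changes ts xs x

changes≤ : ∀ {m} (ts : List (Lin (suc m))) xs x → changes ts xs x ℕ.≤ length ts
changes≤ []       xs x = z≤n
changes≤ (t ∷ ts) xs x = ℕ.+-mono-≤ (change≤1 t xs x) (changes≤ ts xs x)

changes-mono : ∀ {m} (ts : List (Lin (suc m))) xs {x y} → x ℕ.≤ y → changes ts xs x ℕ.≤ changes ts xs y
changes-mono []       xs x≤y = z≤n
changes-mono (t ∷ ts) xs x≤y = ℕ.+-mono-≤ (change-mono t xs x≤y) (changes-mono ts xs x≤y)

-- All summands are monotone, so equal sums force equality of each summand.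
changes-sign : ∀ {m} (ts : List (Lin (suc m))) xs {x y} → x ℕ.≤ y → changes ts xs x ≡ changes ts xs y →
               All (SameSign xs x y) ts
changes-sign []       xs x≤y eq = []
changes-sign (t ∷ ts) xs {x} {y} x≤y eq = change-sign t xs eq₁ ∷ changes-sign ts xs x≤y eq₂
  where
  eq₁ : change t xs x ≡ change t xs y
  eq₁ = ℕ.≤-antisym (change-mono t xs x≤y) (ℕ.+-cancelʳ-≤ _ _ _
    (ℕ.≤-trans (ℕ.≤-reflexive (sym eq)) (ℕ.+-monoʳ-≤ (change t xs x) (changes-mono ts xs x≤y))))
  eq₂ : changes ts xs x ≡ changes ts xs y
  eq₂ = ℕ.+-cancelˡ-≡ _ _ _ (trans eq (cong (ℕ._+ changes ts xs y) (sym eq₁)))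

opaque
  unfolding ⋀

  -- The conjunction is formed to gather the atoms and divisors of all `χ i` at once; the conclusion
  -- concerns each of them separately.
  stable-⋀ : ∀ {m n} (χ : Fin n → QF (suc m)) {xs x y M} → modulus (⋀ n χ) ℕ.∣ M → x ≡ y [mod M ] →
             All (SameSign xs x y) (atoms (⋀ n χ)) → ∀ i → ⟦ χ i ⟧ (x ∷ xs) ⇔ ⟦ χ i ⟧ (y ∷ xs)
  stable-⋀ χ {x = x} {y} d∣M h s zero =
    stable (χ zero) (ℕ.∣-trans (ℕ.m∣m*n _) d∣M) h (All.++⁻ˡ (atoms (χ zero)) s)
  stable-⋀ {n = suc n} χ {x = x} {y} d∣M h s (suc i) =
    stable-⋀ (χ ∘ suc) (ℕ.∣-trans (ℕ.n∣m*n (modulus (χ zero))) d∣M) h (All.++⁻ʳ (atoms (χ zero)) s) i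

-- Translation into Presburger arithmetic

-- The induced letter by recursion instead of minimality. The base case is the default letter,
-- reached when every condition has failed.
First : ∀ {n} → (Fin n → Set) → Fin (suc n) → Set
First {zero}  P a       = ⊤
First {suc n} P zero    = P zero
First {suc n} P (suc a) = ¬ P zero × First (P ∘ suc) a

first : ∀ {n} {P : Fin n → Set} → (∀ i → Dec (P i)) → ∃[ a ] First P a
first {zero}  P? = zero , tt
first {suc n} P? with P? zero
... | yes p = zero , p
... | no ¬p with a , h ← first (P? ∘ suc) = suc a , ¬p , h

First-unique : ∀ {n} {P : Fin n → Set} {a b} → First P a → First P b → a ≡ b
First-unique {zero} {a = zero} {zero} h h′ = refl
First-unique {suc n} {a = zero}  {zero}  h        h′        = refl
First-unique {suc n} {a = zero}  {suc b} h        (¬p , _)  = contradiction h ¬p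
First-unique {suc n} {a = suc a} {zero}  (¬p , _) h′        = contradiction h′ ¬p
First-unique {suc n} {a = suc a} {suc b} (_ , h)  (_ , h′)  = cong suc (First-unique h h′)

First-map : ∀ {n} {P P′ : Fin n → Set} → (∀ i → P i ⇔ P′ i) → ∀ a → First P a → First P′ a
First-map {zero}  e a       h        = tt
First-map {suc n} e zero    h        = to (e zero) h
First-map {suc n} e (suc a) (¬p , h) = ¬p ∘ from (e zero) , First-map (e ∘ suc) a h

InducedLetter : ∀ {n} → (Fin n → Set) → Fin (suc n) → Set
InducedLetter {n} P a =
  (Σ (Fin n) λ j → a ≡ inject₁ j × P j × (∀ j′ → toℕ j′ ℕ.< toℕ j → ¬ P j′)) ⊎ (a ≡ fromℕ n × ∀ j → ¬ P j)

First⇒Induced : ∀ {n} {P : Fin n → Set} a → First P a → InducedLetter P a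
First⇒Induced {zero}  zero    h = inj₂ (refl , λ ())
First⇒Induced {suc n} zero    h = inj₁ (zero , refl , h , λ _ ())
First⇒Induced {suc n} (suc a) (¬p , h) with First⇒Induced a h
... | inj₁ (j , refl , q , least) =
  inj₁ (suc j , refl , q , λ { zero _ → ¬p ; (suc j′) (s≤s lt) → least j′ lt })
... | inj₂ (refl , none) = inj₂ (refl , λ { zero → ¬p ; (suc j) → none j })

Induced⇒First : ∀ {n} {P : Fin n → Set} a → InducedLetter P a → First P a
Induced⇒First {zero}  a       h = tt
Induced⇒First {suc n} .zero   (inj₁ (zero , refl , p , _)) = p
Induced⇒First {suc n} .(suc (inject₁ j)) (inj₁ (suc j , refl , p , least)) =
  least zero (s≤s z≤n) , Induced⇒First _ (inj₁ (j , refl , p , λ j′ lt → least (suc j′) (s≤s lt)))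
Induced⇒First {suc n} .(suc (fromℕ n)) (inj₂ (refl , none)) =
  none zero , Induced⇒First _ (inj₂ (refl , none ∘ suc))

letterIs : ∀ {m n} → (Fin n → QF m) → Fin (suc n) → QF m
letterIs {n = zero}  χ a       = true′
letterIs {n = suc n} χ zero    = χ zero
letterIs {n = suc n} χ (suc a) = not χ zero ∧ letterIs (χ ∘ suc) a

⟦letterIs⟧ : ∀ {m n} (χ : Fin n → QF m) a xs → ⟦ letterIs χ a ⟧ xs ⇔ First (λ i → ⟦ χ i ⟧ xs) a
⟦letterIs⟧ {n = zero}  χ a       xs = mk⇔ (λ _ → tt) (λ _ → ⟦true′⟧ xs)
⟦letterIs⟧ {n = suc n} χ zero    xs = ⇔-refl
⟦letterIs⟧ {n = suc n} χ (suc a) xs = ⇔-refl ×-⇔ ⟦letterIs⟧ (χ ∘ suc) a xs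

holds : ∀ {m} → Bool → QF m
holds true  = true′
holds false = false′

⟦holds⟧ : ∀ {m} b (xs : Vec ℕ m) → ⟦ holds b ⟧ xs ⇔ b ≡ true
⟦holds⟧ true  xs = mk⇔ (λ _ → refl) (λ _ → ⟦true′⟧ xs)
⟦holds⟧ false xs = mk⇔ (λ f → contradiction (⟦true′⟧ xs) f) λ ()

module GroupoidQuantifier {m t′} (G : Groupoid (suc t′)) (S : Fin (suc t′) → Bool) (χ : Fin t′ → QF (suc (suc m))) where

  t = suc t′

  R M : ℕ
  -- The number of changes lies between 0 and the number of atoms, and each of these values labels a
  -- block.
  R = suc (length (atoms (⋀ t′ χ)))
  M = modulus (⋀ t′ χ)

  instance
    M≢0 : NonZero M
    M≢0 = modulus≢0 (⋀ t′ χ)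

  Table : Set
  Table = Fin (R ℕ.* M) → Fin t

  module B (τ : Table) = Blocks G R M τ

  start : Fin R × Fin M
  start = zero , 0 mod M

  sets : Table → Fin t → Fin R × Fin M → List (LinearSet R)
  sets τ a q = parikhImage (B.rules τ) (nt (B.⟨_,_,_⟩ τ start a q))

  n′ : ∀ k → Lin (k ℕ.+ suc m)
  n′ k = weaken k x[ fromℕ m ]

  -- The quantifier runs over all numbers, but `inBlock` confines it to those below the sum of the
  -- block lengths.
  blockLetters : ∀ k → Table → Vec (Lin (k ℕ.+ suc m)) R → QF (k ℕ.+ suc m)
  blockLetters k τ ts = ∀′ (⋀ R λ j → ⋀ M λ ρ →
    (inBlock x[ zero ] (Vec.map (weaken 1) ts) j ∧ residue M ρ) ⇒
    mapLin (weaken₁ k) (letterIs χ (τ (combine j ρ))))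

  linear : Table → LinearSet R → QF (suc m)
  linear τ (b , ps) = ∃⋯ k (total (coords b ps) ≐ suc′ (n′ k) ∧ blockLetters k τ (coords b ps))
    where k = length ps

  run : Table → Fin t → Fin R → Fin M → QF (suc m)
  run τ a i ρ = holds (S a) ∧ ⋁ (length L) λ s → linear τ (List.lookup L s)
    where L = sets τ a (i , ρ)

  -- The right table depends on the values of the free variables, but the number of tables does not,
  -- so a finite disjunction can guess it together with the value of the word and the final state.
  formula : QF (suc m)
  formula = ⋁ (t ^ (R ℕ.* M)) λ c → ⋁ t λ a → ⋁ R λ i → ⋁ M λ ρ → run (finToFun c) a i ρ

  module _ (e : Vec ℕ (suc m)) where

    n : ℕ
    n = lookup e (fromℕ m)

    decideAt : ∀ x i → Dec (⟦ χ i ⟧ (x ∷ e))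
    decideAt x i = ⟦ χ i ⟧? (x ∷ e)

    letterAt : ℕ → Fin t
    letterAt x = proj₁ (first (decideAt x))

    ⟦letterAt⟧ : ∀ x a → ⟦ letterIs χ a ⟧ (x ∷ e) ⇔ letterAt x ≡ a
    ⟦letterAt⟧ x a = ⇔-trans (⟦letterIs⟧ χ a (x ∷ e))
      (mk⇔ (First-unique (proj₂ (first (decideAt x)))) λ { refl → proj₂ (first (decideAt x)) })

    ⟦blockLetters⟧ : ∀ τ {k} (ls : Vec ℕ k) {ts w} → Vals (ls ++ e) ts w →
                     ⟦ blockLetters k τ ts ⟧ (ls ++ e) ⇔ B.Match τ letterAt 0 w
    ⟦blockLetters⟧ τ {k} ls {ts} {w} vs = mk⇔
      (λ h x j b → to (letterAtom x j (x mod M))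
        (to (⟦⇒⟧ _ _ _) (to (⟦⋀⟧ M _ _) (to (⟦⋀⟧ R _ _) (to (⟦∀′⟧ _ _) h x) j) (x mod M))
          (from (block x j) b , from (⟦residue⟧ M (x mod M) x (ls ++ e)) refl)))
      (λ h → from (⟦∀′⟧ _ _) λ x → from (⟦⋀⟧ R _ _) λ j → from (⟦⋀⟧ M _ _) λ ρ → from (⟦⇒⟧ _ _ _) λ (b , r) →
        from (letterAtom x j ρ) (trans (h x j (to (block x j) b))
          (cong (λ ρ → τ (combine j ρ)) (to (⟦residue⟧ M ρ x (ls ++ e)) r))))
      where
      weakened : ∀ x {r} {ts : Vec (Lin (k ℕ.+ suc m)) r} {w} → Vals (ls ++ e) ts w →
                 Vals (x ∷ ls ++ e) (Vec.map (weaken 1) ts) w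
      weakened x [] = []
      weakened x (_∷_ {x = t} v vs) = trans (val-weaken t x (ls ++ e)) v ∷ weakened x vs
      block : ∀ x j → ⟦ inBlock x[ zero ] (Vec.map (weaken 1) ts) j ⟧ (x ∷ ls ++ e) ⇔ InBlock w j x
      block x j = ⟦inBlock⟧ x[ zero ] (Vec.map (weaken 1) ts) j (val-x zero (x ∷ ls ++ e)) (weakened x vs)
      letterAtom : ∀ x j ρ → ⟦ mapLin (weaken₁ k) (letterIs χ (τ (combine j ρ))) ⟧ (x ∷ ls ++ e) ⇔
               letterAt x ≡ τ (combine j ρ)
      letterAtom x j ρ = ⇔-trans (≡⇒⇔ (⟦mapLin⟧ (weaken₁ k) (val-weaken₁ ls x e) (letterIs χ (τ (combine j ρ)))))
        (⟦letterAt⟧ x (τ (combine j ρ)))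

    Fits : Table → Vec ℕ R → Set
    Fits τ w = sum w ≡ suc n × B.Match τ letterAt 0 w

    ⟦linear⟧ : ∀ τ s → ⟦ linear τ s ⟧ e ⇔ (∃[ w ] Linear w s × Fits τ w)
    ⟦linear⟧ τ (b , ps) = ⇔-trans (⟦∃⋯⟧ k _ e) (mk⇔
      (λ (ls , p) → comb b ps ls , from (Linear⇔comb b ps) (ls , refl) , to (fits ls) p)
      λ (w , l , p) → let (ls , eq) = to (Linear⇔comb b ps) l in ls , from (fits ls) (subst (Fits τ) eq p))
      where
      k = length ps
      fits : ∀ ls → ⟦ total (coords b ps) ≐ suc′ (n′ k) ∧ blockLetters k τ (coords b ps) ⟧ (ls ++ e) ⇔
             Fits τ (comb b ps ls)
      fits ls = ⟦≐⟧ (total (coords b ps)) (suc′ (n′ k)) (val-total vs)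
                  (val-suc′ (n′ k) (trans (val-weakens x[ fromℕ m ] ls e) (val-x (fromℕ m) e)))
                ×-⇔ ⟦blockLetters⟧ τ ls vs
        where vs = Vals-coords b ps ls e

    Run : Table → Fin t → Fin R → Fin M → Set
    Run τ a i ρ = S a ≡ true × ∃[ w ] (B.rules τ ⊢ nt (B.⟨_,_,_⟩ τ start a (i , ρ)) ∋ w) × Fits τ w

    ⟦run⟧ : ∀ τ a i ρ → ⟦ run τ a i ρ ⟧ e ⇔ Run τ a i ρ
    ⟦run⟧ τ a i ρ = ⟦holds⟧ (S a) e ×-⇔ ⇔-trans (⟦⋁⟧ _ (λ s → linear τ (List.lookup L s)) e) (mk⇔
      (λ (s , h) → let (w , l , fits) = to (⟦linear⟧ τ (List.lookup L s)) h in
        w , from (parikh (B.rules τ) E w) (lose (∈-lookup s) l) , fits)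
      λ (w , d , fits) → let p = to (parikh (B.rules τ) E w) d in
        index p , from (⟦linear⟧ τ (List.lookup L (index p))) (w , Any.lookup-index p , fits))
      where
      L = sets τ a (i , ρ)
      E = nt (B.⟨_,_,_⟩ τ start a (i , ρ))

    ⋁-cong : ∀ k {φ : Fin k → QF (suc m)} {P : Fin k → Set} → (∀ i → ⟦ φ i ⟧ e ⇔ P i) → ⟦ ⋁ k φ ⟧ e ⇔ ∃ P
    ⋁-cong k {φ} h = ⇔-trans (⟦⋁⟧ k φ e) (mk⇔ (Product.map₂ (to (h _))) (Product.map₂ (from (h _))))

    ⟦formula⟧ : ⟦ formula ⟧ e ⇔ (∃[ c ] ∃[ a ] ∃[ i ] ∃[ ρ ] Run (finToFun c) a i ρ)
    ⟦formula⟧ = ⋁-cong (t ^ (R ℕ.* M)) λ c → ⋁-cong t λ a → ⋁-cong R λ i → ⋁-cong M λ ρ → ⟦run⟧ (finToFun c) a i ρ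

    inducedWord : List (Fin t)
    inducedWord = applyUpTo letterAt (suc n)

    -- Since the count never decreases, its level sets are consecutive intervals; one is empty when
    -- several atoms change at once.
    κ : ℕ → Fin R
    κ x = fromℕ< (s≤s (changes≤ (atoms (⋀ t′ χ)) e x))

    toℕ-κ : ∀ x → toℕ (κ x) ≡ changes (atoms (⋀ t′ χ)) e x
    toℕ-κ x = Fin.toℕ-fromℕ< _

    κ-mono : ∀ x → κ x Fin.≤ κ (suc x)
    κ-mono x = subst₂ ℕ._≤_ (sym (toℕ-κ x)) (sym (toℕ-κ (suc x)))
      (changes-mono (atoms (⋀ t′ χ)) e (ℕ.n≤1+n x))

    letterAt-periodic : ∀ {x y} → x ℕ.≤ y → κ x ≡ κ y → x mod M ≡ y mod M → letterAt x ≡ letterAt y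
    letterAt-periodic {x} {y} x≤y eq eq′ = First-unique
      (First-map (stable-⋀ χ ℕ.∣-refl
        (%≡⇒≡mod M x y (trans (sym (toℕ-mod x M)) (trans (cong toℕ eq′) (toℕ-mod y M))))
        (changes-sign (atoms (⋀ t′ χ)) e x≤y (trans (sym (toℕ-κ x)) (trans (cong toℕ eq) (toℕ-κ y)))))
        (letterAt x) (proj₂ (first (decideAt x))))
      (proj₂ (first (decideAt y)))

    At : Fin R × Fin M → Fin (suc n) → Set
    At (j , ρ) x = κ (toℕ x) ≡ j × toℕ x mod M ≡ ρ

    sample : ∀ p → Dec (∃ (At p)) → Fin t
    sample p (yes (x , _)) = letterAt (toℕ x)
    -- No position has this block and residue, so any letter will do.
    sample p (no _)        = zero

    at? : ∀ p → Dec (∃ (At p))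
    at? (j , ρ) = Fin.any? λ x → (κ (toℕ x) Fin.≟ j) ×-dec (toℕ x mod M Fin.≟ ρ)

    table : Table
    table q = sample (remQuot M q) (at? (remQuot M q))

    sample-correct : ∀ x → x ℕ.< suc n → ∀ (d : Dec (∃ (At (κ x , x mod M)))) → letterAt x ≡ sample (κ x , x mod M) d
    sample-correct x x<n (yes (y , eq , eq′)) with ℕ.≤-total x (toℕ y)
    ... | inj₁ x≤y = letterAt-periodic x≤y (sym eq) (sym eq′)
    ... | inj₂ y≤x = sym (letterAt-periodic y≤x eq eq′)
    sample-correct x x<n (no ¬p) = contradiction
      (fromℕ< x<n , cong κ (Fin.toℕ-fromℕ< x<n) , cong (_mod M) (Fin.toℕ-fromℕ< x<n)) ¬p

    table-correct : ∀ x → x ℕ.< suc n → letterAt x ≡ table (combine (κ x) (x mod M))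
    table-correct x x<n = trans (sample-correct x x<n (at? (κ x , x mod M)))
      (cong (λ p → sample p (at? p)) (sym (Fin.remQuot-combine (κ x) (x mod M))))

    accepted⇒InW : ∀ τ {a i ρ} → Run τ a i ρ → InW G S inducedWord
    accepted⇒InW τ {a} (Sa , w , d , total , match) with u , π , ev ← B.sound τ d =
      a , subst (λ u → Evaluates G u a) (trans (B.path-word τ 0 π match)
            (cong (applyUpTo letterAt) (trans (sym (B.Path-length τ π)) total))) ev , Sa

    -- Without function extensionality, decoding the code of `table` gives it back only pointwise;
    -- the path is therefore built for the decoded table.
    table′ : Table
    table′ = finToFun (funToFin table)

    InW⇒accepted : InW G S inducedWord → ∃[ c ] ∃[ a ] ∃[ i ] ∃[ ρ ] Run (finToFun c) a i ρ
    InW⇒accepted (a , ev , Sa)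
      with w , (i , ρ) , π ← B.make-path table′ κ {letterAt} 0 κ-mono z≤n (suc n)
             (λ x x<n → trans (table-correct x x<n) (sym (Fin.finToFun-funToFin table _))) =
      funToFin table , a , i , ρ , Sa , w , B.complete table′ ev π ,
      trans (B.Path-length table′ π) (length-applyUpTo letterAt (suc n)) , B.word-match table′ 0 (suc n) π

    ⟦formula⟧⇔InW : ⟦ formula ⟧ e ⇔ InW G S inducedWord
    ⟦formula⟧⇔InW = ⇔-trans ⟦formula⟧ (mk⇔ (λ (c , _ , _ , _ , r) → accepted⇒InW (finToFun c) r) InW⇒accepted)

term : ∀ {m} → Term m → Lin (suc m)
term (var i) = x[ inject₁ i ]
term tmin    = const 0ℤ
term {m} tmax = x[ fromℕ m ]

translate : ∀ {m} → Formula 1 false m → QF (suc m)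
translate (letter a t) = true′
translate (less t u)   = suc′ (term t) ≤′ term u
translate (equal t u)  = term t ≐ term u
translate (neg φ)      = not translate φ
translate (conj φ ψ)   = translate φ ∧ translate ψ
-- Presburger variables range over all of ℕ, so the witness is bounded by the greatest position.
translate {m} (ex φ)   = ∃′ (x[ zero ] ≤′ x[ fromℕ (suc m) ] ∧ translate φ)
translate (grp t′ G S φs) = GroupoidQuantifier.formula G S (λ j → translate (φs j))

-- The last variable holds the greatest position.
Agree : ∀ {m n} → (Fin m → Fin (suc n)) → Vec ℕ (suc m) → Set
Agree {m} {n} env e = (∀ i → toℕ (env i) ≡ lookup e (inject₁ i)) × n ≡ lookup e (fromℕ m)

term-correct : ∀ {m n} (t : Term m) {env : Fin m → Fin (suc n)} {e} → Agree env e →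
               val (term t) e ≡ + toℕ (evalT env t)
term-correct (var i) {e = e} (h , _) = trans (val-x (inject₁ i) e) (cong +_ (sym (h i)))
term-correct tmin    {e = e} _       = val-const 0ℤ e
term-correct {m} {n} tmax {e = e} (_ , h) =
  trans (val-x (fromℕ m) e) (cong +_ (trans (sym h) (sym (Fin.toℕ-fromℕ n))))

toList-applyUpTo : ∀ {A : Set} {n} (v : Vec A n) (f : ℕ → A) → (∀ i → lookup v i ≡ f (toℕ i)) → toList v ≡ applyUpTo f n
toList-applyUpTo []      f h = refl
toList-applyUpTo (a ∷ v) f h = cong₂ _∷_ (h zero) (toList-applyUpTo v (f ∘ suc) (h ∘ suc))

module _ {n} (w : Vec (Fin 1) (suc n)) where

  -- The truth of the inner formulas is a parameter `P` because the extended environment is local to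
  -- the definition of `Sat` and has no name here.
  induced : ∀ {m t′} (G : Groupoid (suc t′)) S (χ : Fin t′ → QF (suc (suc m))) {e} → n ≡ lookup e (fromℕ m) →
            (P : Fin (suc n) → Fin t′ → Set) → (∀ p j → P p j ⇔ ⟦ χ j ⟧ (toℕ p ∷ e)) →
            (∃[ v ] (∀ (i : Fin (suc n)) → InducedLetter (P i) (lookup v i)) × InW G S (toList v)) ⇔
            ⟦ GroupoidQuantifier.formula G S χ ⟧ e
  induced G S χ {e} refl P h = ⇔-trans (mk⇔
    (λ (v , letters , inW) → subst (InW G S) (toList-applyUpTo v (Q.letterAt e) λ i → First-unique
        (First-map (h i) _ (Induced⇒First _ (letters i))) (proj₂ (first (Q.decideAt e (toℕ i))))) inW)
    (λ inW → tabulate (Q.letterAt e ∘ toℕ) ,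
      (λ i → First⇒Induced _ (First-map (λ j → ⇔-sym (h i j)) _
        (subst (First _) (sym (Vec.lookup∘tabulate (Q.letterAt e ∘ toℕ) i)) (proj₂ (first (Q.decideAt e (toℕ i))))))) ,
      subst (InW G S) (sym (toList-applyUpTo _ (Q.letterAt e) (Vec.lookup∘tabulate (Q.letterAt e ∘ toℕ)))) inW))
    (⇔-sym (Q.⟦formula⟧⇔InW e))
    where module Q = GroupoidQuantifier G S χ

  only-letter : (a b : Fin 1) → a ≡ b
  only-letter zero zero = refl

  translate-correct : ∀ {m} (ψ : Formula 1 false m) {env : Fin m → Fin (suc n)} {e} → Agree env e →
                      Sat ψ w env ⇔ ⟦ translate ψ ⟧ e
  translate-correct (letter a t) {e = e} h = mk⇔ (λ _ → ⟦true′⟧ e) (λ _ → only-letter _ a)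
  translate-correct (less t u) h =
    ⇔-sym (⟦≤′⟧ (suc′ (term t)) (term u) (val-suc′ (term t) (term-correct t h)) (term-correct u h))
  translate-correct (equal t u) h = ⇔-trans (mk⇔ (cong toℕ) Fin.toℕ-injective)
    (⇔-sym (⟦≐⟧ (term t) (term u) (term-correct t h) (term-correct u h)))
  translate-correct (neg φ) h = ¬-⇔ (translate-correct φ h)
  translate-correct (conj φ ψ) h = translate-correct φ h ×-⇔ translate-correct ψ h
  translate-correct {m} (ex φ) {env} {e} (h , refl) = ⇔-trans (mk⇔
    (λ (p , s) → toℕ p , from (bound (toℕ p)) (Fin.toℕ≤pred[n] p) ,
       to (translate-correct φ ((λ { zero → refl ; (suc i) → h i }) , refl)) s)
    (λ (x , b , s) → let x<n = s≤s (to (bound x) b) in fromℕ< x<n ,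
       from (translate-correct φ ((λ { zero → Fin.toℕ-fromℕ< x<n ; (suc i) → h i }) , refl)) s))
    (⇔-sym (⟦∃′⟧ _ e))
    where
    bound : ∀ x → ⟦ x[ zero ] ≤′ x[ fromℕ (suc m) ] ⟧ (x ∷ e) ⇔ x ℕ.≤ lookup e (fromℕ m)
    bound x = ⟦≤′⟧ x[ zero ] x[ fromℕ (suc m) ] {x ∷ e} (val-x zero (x ∷ e)) (val-x (fromℕ (suc m)) (x ∷ e))
  translate-correct {m} (grp t′ G S φs) {env} {e} (h , eq) =
    induced G S (λ j → translate (φs j)) eq _
      (λ p j → translate-correct (φs j) ((λ { zero → refl ; (suc i) → h i }) , eq))

-- Powers of two

2*/2 : ∀ m → 2 ℕ.* m / 2 ≡ m
2*/2 m = trans (cong (_/ 2) (ℕ.*-comm 2 m)) (m*n/n≡m m 2)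

halve : ∀ m → m % 2 ≢ 1 → m ≡ 2 ℕ.* (m / 2)
halve m odd with m % 2 | m%n<n m 2 | m≡m%n+[m/n]*n m 2
... | 0             | _ | eq = trans eq (ℕ.*-comm (m / 2) 2)
... | 1             | _ | eq = contradiction refl odd
... | suc (suc _)   | s≤s (s≤s ()) | eq

bitOf-0 : ∀ j → bitOf j 0 ≡ 0
bitOf-0 zero    = refl
bitOf-0 (suc j) = bitOf-0 j

bitOf-2^ : ∀ i → bitOf i (2 ^ i) ≡ 1
bitOf-2^ zero    = refl
bitOf-2^ (suc i) = trans (cong (bitOf i) (2*/2 (2 ^ i))) (bitOf-2^ i)

bitOf-2^-unique : ∀ i j → bitOf j (2 ^ i) ≡ 1 → j ≡ i
bitOf-2^-unique zero    zero    h = refl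
bitOf-2^-unique zero    (suc j) h = contradiction (trans (sym (bitOf-0 j)) h) λ ()
bitOf-2^-unique (suc i) zero    h =
  contradiction (trans (sym (trans (cong (_% 2) (ℕ.*-comm 2 (2 ^ i))) (m*n%n≡0 (2 ^ i) 2))) h) λ ()
bitOf-2^-unique (suc i) (suc j) h =
  cong suc (bitOf-2^-unique i j (trans (cong (bitOf j) (sym (2*/2 (2 ^ i)))) h))

-- Ensures that every 1 in the binary representation of the length is addressed by some position, so
-- that quantification over positions misses none.
bitOf⇒< : ∀ j m → bitOf j m ≡ 1 → j ℕ.< m
bitOf⇒< zero    (suc m) h = s≤s z≤n
bitOf⇒< (suc j) zero    h = contradiction (trans (sym (bitOf-0 j)) h) λ ()
bitOf⇒< (suc j) m@(suc _) h = ℕ.≤-<-trans (bitOf⇒< j (m / 2) h) (m/n<m m 2 (s≤s (s≤s z≤n)))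

no-bits : ∀ m → (∀ j → bitOf j m ≢ 1) → m ≡ 0
no-bits = <-rec _ step
  where
  step : ∀ m → (∀ {l} → l ℕ.< m → (∀ j → bitOf j l ≢ 1) → l ≡ 0) → (∀ j → bitOf j m ≢ 1) → m ≡ 0
  step zero      rec h = refl
  step m@(suc _) rec h = trans (halve m (h 0))
    (cong (2 ℕ.*_) (rec (m/n<m m 2 (s≤s (s≤s z≤n))) (h ∘ suc)))

single-bit : ∀ i m → bitOf i m ≡ 1 → (∀ j → bitOf j m ≡ 1 → j ≡ i) → m ≡ 2 ^ i
single-bit zero m h only = trans (m≡m%n+[m/n]*n m 2)
  (cong₂ (λ a b → a ℕ.+ b ℕ.* 2) h (no-bits (m / 2) λ j b → contradiction (only (suc j) b) λ ()))
single-bit (suc i) m h only = trans (halve m (λ b → contradiction (only 0 b) λ ()))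
  (cong (2 ℕ.*_) (single-bit i (m / 2) h λ j b → ℕ.suc-injective (only (suc j) b)))

-- The greatest element of the universe equals the length, so the sentence says that the length has
-- exactly one binary digit 1.
powerOf2 : Sentence 1 true
powerOf2 = ex (conj (bit (var zero) tmax)
  (neg (ex (conj (bit (var zero) tmax) (neg (equal (var zero) (var (suc zero))))))))

powerOf2-correct : ∀ {n} (w : Vec (Fin 1) (suc n)) → (w ⊨ powerOf2) ⇔ (∃[ i ] suc n ≡ 2 ^ i)
powerOf2-correct {n} w rewrite Fin.toℕ-fromℕ n = mk⇔
  (λ (p , h , none) → toℕ p , single-bit (toℕ p) (suc n) h λ j b →
    let j<n = bitOf⇒< j (suc n) b in
    trans (sym (Fin.toℕ-fromℕ< j<n)) (cong toℕ (decidable-stable (fromℕ< j<n Fin.≟ p) λ j≢p →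
      none (fromℕ< j<n , subst (λ j → bitOf j (suc n) ≡ 1) (sym (Fin.toℕ-fromℕ< j<n)) b , j≢p))))
  (λ (i , eq) → let b = trans (cong (bitOf i) eq) (bitOf-2^ i)
                    i<n = bitOf⇒< i (suc n) b
                    toℕ-i = Fin.toℕ-fromℕ< i<n in
    fromℕ< i<n , subst (λ j → bitOf j (suc n) ≡ 1) (sym toℕ-i) b ,
    λ (q , b , q≢i) → q≢i (Fin.toℕ-injective (trans
      (bitOf-2^-unique i (toℕ q) (trans (cong (bitOf (toℕ q)) (sym eq)) b)) (sym toℕ-i))))

n<2^n : ∀ n → n ℕ.< 2 ^ n
n<2^n zero    = s≤s z≤n
n<2^n (suc n) = ℕ.+-mono-≤-< (ℕ.m^n>0 2 n) (subst (n ℕ.<_) (sym (ℕ.+-identityʳ (2 ^ n))) (n<2^n n))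

-- The sum lies strictly between 2^k and 2^(k+1). It is applied with m the modulus of a formula and
-- k ≥ m, where `n<2^n` supplies the upper bound.
between-powers : ∀ k m → 0 ℕ.< m → m ℕ.< 2 ^ k → ∀ i → 2 ^ k ℕ.+ m ≢ 2 ^ i
between-powers k m 0<m m<2^k i eq with i ℕ.≤? k
... | yes i≤k = ℕ.<-irrefl (sym eq) (ℕ.≤-<-trans (ℕ.^-monoʳ-≤ 2 i≤k) (ℕ.m<m+n (2 ^ k) 0<m))
... | no i≰k  = ℕ.<-irrefl eq (ℕ.<-≤-trans
  (subst (2 ^ k ℕ.+ m ℕ.<_) (cong (2 ^ k ℕ.+_) (sym (ℕ.+-identityʳ (2 ^ k)))) (ℕ.+-monoʳ-< (2 ^ k) m<2^k))
  (ℕ.^-monoʳ-≤ 2 (ℕ.≰⇒> i≰k)))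

-- Each gap between consecutive large powers of two contains a change of sign of an atom: otherwise
-- 2 ^ k and 2 ^ k + M could not be told apart.
¬definable : ∀ (ξ : QF 1) → ¬ (∀ n → ⟦ ξ ⟧ (n ∷ []) ⇔ (∃[ i ] suc n ≡ 2 ^ i))
¬definable ξ h = ℕ.<-irrefl refl (ℕ.≤-trans (grows (suc (length ts))) (changes≤ ts [] (point (suc (length ts)))))
  where
  M = modulus ξ
  ts = atoms ξ
  point : ℕ → ℕ
  point j = ℕ.pred (2 ^ (M ℕ.+ j))
  suc-point : ∀ j → suc (point j) ≡ 2 ^ (M ℕ.+ j)
  suc-point j = ℕ.suc-pred (2 ^ (M ℕ.+ j)) {{ℕ.m^n≢0 2 (M ℕ.+ j)}}
  M<2^ : ∀ j → M ℕ.< 2 ^ (M ℕ.+ j)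
  M<2^ j = ℕ.<-≤-trans (n<2^n M) (ℕ.^-monoʳ-≤ 2 (ℕ.m≤m+n M j))
  0<M : 0 ℕ.< M
  0<M = ℕ.>-nonZero⁻¹ M {{modulus≢0 ξ}}
  step : ∀ j → changes ts [] (point j) ≢ changes ts [] (point j ℕ.+ M)
  step j eq = between-powers (M ℕ.+ j) M 0<M (M<2^ j) (proj₁ power)
      (trans (cong (ℕ._+ M) (sym (suc-point j))) (proj₂ power))
    where
    periodic : point j ≡ point j ℕ.+ M [mod M ]
    periodic = ≡mod-sym {point j ℕ.+ M} {point j} (+-period (point j) M)
    power : ∃[ i ] suc (point j ℕ.+ M) ≡ 2 ^ i
    power = to (h _) (to (stable ξ ℕ.∣-refl periodic (changes-sign ts [] (ℕ.m≤m+n (point j) M) eq))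
                         (from (h _) (M ℕ.+ j , suc-point j)))
  next : ∀ j → point j ℕ.+ M ℕ.≤ point (suc j)
  next j = ℕ.≤-pred (begin
    suc (point j) ℕ.+ M                   ≡⟨ cong (ℕ._+ M) (suc-point j) ⟩
    2 ^ (M ℕ.+ j) ℕ.+ M                   ≤⟨ ℕ.+-monoʳ-≤ _ (ℕ.<⇒≤ (M<2^ j)) ⟩
    2 ^ (M ℕ.+ j) ℕ.+ 2 ^ (M ℕ.+ j)       ≡⟨ cong (2 ^ (M ℕ.+ j) ℕ.+_) (ℕ.+-identityʳ _) ⟨
    2 ^ suc (M ℕ.+ j)                     ≡⟨ cong (2 ^_) (ℕ.+-suc M j) ⟨
    2 ^ (M ℕ.+ suc j)                     ≡⟨ suc-point (suc j) ⟨
    suc (point (suc j))                   ∎)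
    where open ℕ.≤-Reasoning
  grows : ∀ j → j ℕ.≤ changes ts [] (point j)
  grows zero    = z≤n
  grows (suc j) = ℕ.≤-trans (ℕ.≤-<-trans (grows j)
    (ℕ.≤∧≢⇒< (changes-mono ts [] (ℕ.m≤m+n (point j) M)) (step j)))
    (changes-mono ts [] (next j))

theorem26 : Σ ℕ λ k → Σ (Sentence k true) λ φ →
    ¬ (Σ (Sentence k false) λ ψ → SameLanguage φ ψ)
theorem26 = 1 , powerOf2 , λ (ψ , same) → ¬definable (translate ψ) λ n →
  let w = replicate (suc n) zero in
  ⇔-trans (⇔-sym (translate-correct w ψ ((λ ()) , refl)))
    (⇔-trans (mk⇔ (proj₂ (same n w)) (proj₁ (same n w))) (powerOf2-correct w))
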